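{- Let $p,q\geq 1$, $s\in\mathcal{Y}_p$, $t\in\mathcal{Y}_q$, and $r\in\mathcal{Y}_{p+q}$. The coefficient of $M_r$ in the product $M_s\cdot M_t$ in $\mathcal{Y}Sym$ equals the number of $\zeta\in\mathrm{Sh}(p,q)$ such that the set $\{(s',t')\in\mathcal{Y}_p\times\mathcal{Y}_q\mid f_\zeta(s',t')\leq r\}$ has a maximum element (for the product order) and this maximum is $(s,t)$.
   Context: $\mathfrak{S}_n$: permutations of $[n]$ in one-line notation with the weak order (inclusion of inversion sets). Composition: $(\sigma\cdot\zeta)(i)=\sigma(\zeta(i))$. For $\sigma\in\mathfrak{S}_p,\tau\in\mathfrak{S}_q$: $\sigma/\tau\in\mathfrak{S}_{p+q}$ has values $\sigma(1),\dots,\sigma(p),\tau(1)+p,\dots,\tau(q)+p$; $\sigma\vee\tau\in\mathfrak{S}_{p+q+1}$ has values $\sigma(1)+q,\dots,\sigma(p)+q,p+q+1,\tau(1),\dots,\tau(q)$. $\mathrm{Sh}(p,q)=\{\zeta\in\mathfrak{S}_{p+q}:\zeta\text{ has no descent except possibly at position }p\}$. $\mathrm{st}$ denotes standardization of a sequence of distinct integers. $\mathcal{Y}_n$: rooted planar binary trees with $n$ internal nodes, $\mathcal{Y}_0=\{|\}$, each $t$ uniquely $t_l\vee t_r$; Tamari order generated by replacing a subtree $(A\vee B)\vee C$ by $A\vee(B\vee C)$; $1_n$ its minimum. $\lambda\colon\mathfrak{S}_n\to\mathcal{Y}_n$: $\lambda(\mathrm{id}_0)=|$, $\lambda(\sigma)=\lambda(\mathrm{st}(\sigma(1..j-1)))\vee\lambda(\mathrm{st}(\sigma(j+1..n)))$,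 $j=\sigma^{ -1}(n)$. $\gamma\colon\mathcal{Y}_n\to\mathfrak{S}_n$: $\gamma(|)=\mathrm{id}_0$, $\gamma(t)=\gamma(t_l)\vee\gamma(t_r)$. For $\zeta\in\mathrm{Sh}(p,q)$ define $f_\zeta\colon\mathcal{Y}_p\times\mathcal{Y}_q\to\mathcal{Y}_{p+q}$ by $f_\zeta(s,t)=\lambda\big((\gamma(s)/\gamma(t))\cdot\zeta^{ -1}\big)$. $\mathcal{Y}Sym$ is the graded Hopf algebra over $\mathbb{Q}$ with basis $\{F_t\}$ over all planar binary trees (the graded dual of the Loday–Ronco Hopf algebra); its product is $F_s\cdot F_t=\sum_{\zeta\in\mathrm{Sh}(p,q)}F_{\lambda((\gamma(s)/\gamma(t))\cdot\zeta^{ -1})}$ for $s\in\mathcal{Y}_p,t\in\mathcal{Y}_q$ (equivalently, the map $F_\sigma\mapsto F_{\lambda(\sigma)}$ from the Malvenuto–Reutenauer algebra with $F_\sigma\cdot F_\tau=\sum_{\zeta\in\mathrm{Sh}(p,q)}F_{(\sigma/\tau)\cdot\zeta^{ -1}}$ is an algebra morphism). The monomial basis is $M_t=\sum_{s\geq t}\mu_{\mathcal{Y}_n}(t,s)F_s$, where $\mu_{\mathcal{Y}_n}$ is the Möbius function of the Tamari order. -}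

module Defs where

open import Data.Bool using (Bool; true; false; if_then_else_)
open import Data.Nat as ℕ using (ℕ; zero; suc; _+_; _∸_; _<_; _≡ᵇ_)
import Data.Nat.Properties as ℕP
open import Data.Integer as ℤ using (ℤ; +_; 0ℤ; 1ℤ)
open import Data.List using (List; []; _∷_; _++_; map; length; filter; concatMap; upTo; break)
open import Data.List.Relation.Unary.All using (All; all?)
open import Data.Product using (_×_; _,_; proj₁; proj₂)
open import Data.Sum using (_⊎_)
open import Relation.Binary using (Rel; Decidable)
open import Relation.Binary.PropositionalEquality using (_≡_; refl; cong₂)
open import Relation.Nullary using (Dec; yes; no; ¬_; ¬?)
open import Relation.Nullary.Decidable using (_×-dec_; _→-dec_; _⊎-dec_)
open import Relation.Binary.Construct.Closure.ReflexiveTransitive using (Star)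

-- Permutations in one-line notation, as lists of values in [n] = {1..n}

Perm : Set
Perm = List ℕ

-- σ(i), 1-based (junk value 0 outside [1, length σ])
at : Perm → ℕ → ℕ
at []       _             = 0
at (x ∷ xs) zero          = 0
at (x ∷ xs) (suc zero)    = x
at (x ∷ xs) (suc (suc i)) = at xs (suc i)

range1 : ℕ → List ℕ
range1 n = map suc (upTo n)

_·_ : Perm → Perm → Perm
σ · ζ = map (at σ) ζ

pos : Perm → ℕ → ℕ
pos []       v = 0
pos (x ∷ xs) v = if x ≡ᵇ v then 1 else suc (pos xs v)

inv : Perm → Perm
inv ζ = map (pos ζ) (range1 (length ζ))

_/_ : Perm → Perm → Perm
σ / τ = σ ++ map (_+ length σ) τ

_∨_ : Perm → Perm → Perm
σ ∨ τ = map (_+ length τ) σ ++ (length σ + length τ + 1) ∷ τ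

count : {A : Set} {P : A → Set} → ((x : A) → Dec (P x)) → List A → ℕ
count P? xs = length (filter P? xs)

st : List ℕ → Perm
st xs = map (λ x → suc (count (λ y → y ℕ.<? x) xs)) xs

insertions : ℕ → Perm → List Perm
insertions a []       = (a ∷ []) ∷ []
insertions a (x ∷ xs) = (a ∷ x ∷ xs) ∷ map (x ∷_) (insertions a xs)

perms : ℕ → List Perm
perms zero    = [] ∷ []
perms (suc n) = concatMap (insertions (suc n)) (perms n)

NoDescentExcept : ℕ → Perm → Set
NoDescentExcept p ζ =
  All (λ i → i ≡ p ⊎ at ζ i < at ζ (suc i)) (range1 (length ζ ∸ 1))

noDescentExcept? : (p : ℕ) (ζ : Perm) → Dec (NoDescentExcept p ζ)
noDescentExcept? p ζ =
  all? (λ i → (i ℕ.≟ p) ⊎-dec (at ζ i ℕ.<? at ζ (suc i))) (range1 (length ζ ∸ 1))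

Sh : ℕ → ℕ → List Perm
Sh p q = filter (noDescentExcept? p) (perms (p + q))

data BT : Set where
  leaf : BT
  node : BT → BT → BT

size : BT → ℕ
size leaf       = 0
size (node l r) = suc (size l + size r)

-- all trees of depth ≤ d (each exactly once)
upToDepth : ℕ → List BT
upToDepth zero    = leaf ∷ []
upToDepth (suc d) = leaf ∷ concatMap (λ l → map (node l) (upToDepth d)) (upToDepth d)

-- 𝒴_n : all trees with n internal nodes (they all have depth ≤ n)
trees : ℕ → List BT
trees n = filter (λ t → size t ℕ.≟ n) (upToDepth n)

_≟BT_ : Decidable {A = BT} _≡_
leaf ≟BT leaf = yes refl
leaf ≟BT node _ _ = no (λ ())
node _ _ ≟BT leaf = no (λ ())
node l r ≟BT node l' r' with l ≟BT l' | r ≟BT r'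
... | yes refl | yes refl = yes refl
... | no ne | _ = no (λ { refl → ne refl })
... | yes _ | no ne = no (λ { refl → ne refl })

data _⟶_ : BT → BT → Set where
  rot   : ∀ {A B C} → node (node A B) C ⟶ node A (node B C)
  left  : ∀ {s s' t} → s ⟶ s' → node s t ⟶ node s' t
  right : ∀ {s t t'} → t ⟶ t' → node s t ⟶ node s t'

_≤T_ : Rel BT _
_≤T_ = Star _⟶_

-- fuel-driven recursion; fuel = length σ suffices
λgo : ℕ → Perm → BT
λgo zero    _ = leaf
λgo (suc k) [] = leaf
λgo (suc k) σ@(_ ∷ _) with break (λ x → x ℕ.≟ length σ) σ
... | (l , [])    = leaf   -- does not happen for permutations
... | (l , _ ∷ r) = node (λgo k (st l)) (λgo k (st r))

λ𝒴 : Perm → BT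
λ𝒴 σ = λgo (length σ) σ

γ : BT → Perm
γ leaf       = []
γ (node l r) = γ l ∨ γ r

f : Perm → BT → BT → BT
f ζ s t = λ𝒴 ((γ s / γ t) · inv ζ)

-- 𝒴Sym: a homogeneous element is given by its coefficients on the
-- fundamental basis F, i.e. a function BT → ℤ (coefficient of F_u).

sumZ : {A : Set} → List A → (A → ℤ) → ℤ
sumZ []       g = 0ℤ
sumZ (x ∷ xs) g = g x ℤ.+ sumZ xs g

-- coefficient of F_u in F_s · F_t  (s ∈ 𝒴_p, t ∈ 𝒴_q)
FF : ℕ → ℕ → BT → BT → BT → ℤ
FF p q s t u = + count (λ ζ → f ζ s t ≟BT u) (Sh p q)

prod : ℕ → ℕ → (BT → ℤ) → (BT → ℤ) → BT → ℤ
prod p q X Y u =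
  sumZ (trees p) λ s → sumZ (trees q) λ t → X s ℤ.* Y t ℤ.* FF p q s t u

-- Everything involving the Möbius function is parametrised by a decision
-- procedure for the Tamari order (the result does not depend on it).
module WithDec (_≤?_ : Decidable _≤T_) where

  -- Möbius function: μ(t,t) = 1, μ(t,s) = - Σ_{t ≤ u < s} μ(t,u) for t < s,
  -- 0 if t ≰ s.  Fuel |𝒴_n| bounds the length of chains in 𝒴_n.
  μgo : ℕ → BT → BT → ℤ
  μgo zero    t s = 0ℤ
  μgo (suc k) t s with t ≟BT s
  ... | yes _ = 1ℤ
  ... | no _ with t ≤? s
  ...   | no _  = 0ℤ
  ...   | yes _ = ℤ.- sumZ (filter (λ u → (t ≤? u) ×-dec ((u ≤? s) ×-dec ¬? (u ≟BT s)))
                                   (trees (size t)))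
                           (μgo k t)

  μ : BT → BT → ℤ
  μ t s = μgo (length (trees (size t))) t s

  -- M_t = Σ_{s ≥ t} μ(t,s) F_s, as its vector of F-coefficients
  M : BT → BT → ℤ
  M t u with t ≤? u
  ... | yes _ = μ t u
  ... | no _  = 0ℤ

  MaxIs : ℕ → ℕ → Perm → BT → BT → BT → Set
  MaxIs p q ζ r s t =
    (f ζ s t ≤T r) ×
    All (λ s' → All (λ t' → f ζ s' t' ≤T r → (s' ≤T s × t' ≤T t)) (trees q)) (trees p)

  maxIs? : (p q : ℕ) (r s t : BT) (ζ : Perm) → Dec (MaxIs p q ζ r s t)
  maxIs? p q r s t ζ =
    (f ζ s t ≤? r) ×-dec
    all? (λ s' → all? (λ t' → (f ζ s' t' ≤? r) →-dec ((s' ≤? s) ×-dec (t' ≤? t))) (trees q)) (trees p)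

  coeff : ℕ → ℕ → BT → BT → BT → ℕ
  coeff p q s t r = count (maxIs? p q r s t) (Sh p q)

{-# OPTIONS --safe #-}
module Submission where

-- Number the nodes of a tree in inorder. Then s ≤ t in the Tamari order iff
-- every pair (i , j) with i in the left subtree of j in t has this property in
-- s as well. As λ(w) is the decreasing tree of the word w, it follows that
-- λ(w) ≤ r iff w(i) < w(j) for every such pair (i , j) of r. Apply this to
-- w = (γ(s)/γ(t)) · ζ⁻¹: two letters of w that come from the same factor
-- compare according to s or t, and two letters from different factors compare
-- in a way that depends only on ζ. Hence {(s , t) | f ζ s t ≤ r} is either
-- empty or the principal ideal of (s₀ , t₀), where s₀ and t₀ are obtained by
-- restricting r to the positions of the two factors. Summing the coefficients
-- of M s · M t over u ≤ r then leaves, by Σ_{s ≤ s′ ≤ s₀} μ(s , s′) = δ(s , s₀),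
-- exactly one contribution for each ζ whose maximum is (s , t), and these sums
-- over principal ideals determine an element of 𝒴Sym.

open import Defs
open import Algebra.Properties.AbelianGroup using (∙-cancelˡ)
open import Data.Bool using (true; false)
open import Data.Empty using (⊥-elim)
open import Data.Integer using (ℤ; _*_; 0ℤ; 1ℤ) renaming (_+_ to _⊕_; -_ to ⊖_)
import Data.Integer.Properties as ℤ
open import Data.Integer.Tactic.RingSolver using (solve-∀)
open import Data.List using (List; []; _∷_; [_]; _++_; map; length; filter; break; upTo; concatMap; cartesianProductWith)
open import Data.List.Membership.Propositional using (_∈_; find; lose)
open import Data.List.Membership.Propositional.Properties
import Data.List.Properties as List
open import Data.List.Relation.Binary.Permutation.Propositional using (_↭_; prep; swap; ↭-refl; ↭-sym; ↭-trans; ↭-reflexive; ↭⇒↭ₛ)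
import Data.List.Relation.Binary.Permutation.Propositional.Properties as Perm
import Data.List.Relation.Binary.Permutation.Setoid.Properties as PermSetoid
open import Data.List.Relation.Unary.All using (All; []; _∷_)
import Data.List.Relation.Unary.All as All
import Data.List.Relation.Unary.All.Properties as All
open import Data.List.Relation.Unary.AllPairs using ([]; _∷_)
open import Data.List.Relation.Unary.Any using (any?; here; there)
import Data.List.Relation.Unary.Any as Any
open import Data.List.Relation.Unary.Unique.Propositional using (Unique)
import Data.List.Relation.Unary.Unique.Propositional.Properties as Unique
open import Data.Nat using (ℕ; zero; suc; pred; _≤_; _<_; _+_; _∸_; z≤n; s≤s; _≤?_; _<?_; _≟_; _≡ᵇ_)
open import Data.Nat.Properties hiding (_≤?_; _<?_; _≟_)
import Data.Nat.Tactic.RingSolver as ℕ-Solver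
open import Data.Product using (∃; ∃₂; _×_; _,_; proj₁; proj₂)
open import Data.Sum using (_⊎_; inj₁; inj₂)
open import Function using (_∘_)
open import Relation.Binary using (Decidable; tri<; tri≈; tri>)
open import Relation.Binary.Construct.Closure.ReflexiveTransitive using (ε; _◅_; _◅◅_; gmap)
open import Relation.Binary.PropositionalEquality hiding ([_])
open import Relation.Nullary using (Dec; yes; no; ¬_; ¬?; contradiction)
open import Relation.Nullary.Decidable using (_×-dec_)

-- The Tamari order

-- InLeft t i j: numbering the nodes of t in inorder from 0, node i lies in
-- the left subtree of node j.
data InLeft : BT → ℕ → ℕ → Set where
  inˡ  : ∀ {l r i j} → InLeft l i j → InLeft (node l r) i j
  root : ∀ {l r i} → i < size l → InLeft (node l r) i (size l)
  inʳ  : ∀ {l r i j} → InLeft r i j →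
         InLeft (node l r) (suc (size l) + i) (suc (size l) + j)

InLeft-< : ∀ {t i j} → InLeft t i j → i < j
InLeft-< (inˡ h)        = InLeft-< h
InLeft-< (root h)       = h
InLeft-< (inʳ {l} h) = +-monoʳ-< (suc (size l)) (InLeft-< h)

InLeft-bound : ∀ {t i j} → InLeft t i j → j < size t
InLeft-bound {node l r} (inˡ h)  = m<n⇒m<1+n (<-≤-trans (InLeft-bound h) (m≤m+n _ _))
InLeft-bound {node l r} (root h) = s≤s (m≤m+n _ _)
InLeft-bound {node l r} (inʳ h)  = +-monoʳ-< (suc (size l)) (InLeft-bound h)

InLeft-boundˡ : ∀ {t i j} → InLeft t i j → i < size t
InLeft-boundˡ h = <-trans (InLeft-< h) (InLeft-bound h)

-- The left subtree of node `j` occupies an interval of the inorder that ends just before `j`.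
InLeft-interval : ∀ {t i j m} → InLeft t i j → i ≤ m → m < j → InLeft t m j
InLeft-interval (inˡ h) i≤m m<j = inˡ (InLeft-interval h i≤m m<j)
InLeft-interval (root h) i≤m m<j = root m<j
InLeft-interval {m = m} (inʳ {l} {r} {i} {j} h) i≤m m<j =
  subst (λ x → InLeft (node l r) x (suc (size l) + j)) eq
    (inʳ (InLeft-interval h (+-cancelˡ-≤ (suc (size l)) _ _ (subst (suc (size l) + i ≤_) (sym eq) i≤m))
                            (+-cancelˡ-< (suc (size l)) _ _ (subst (_< suc (size l) + j) (sym eq) m<j))))
  where
  eq : suc (size l) + (m ∸ suc (size l)) ≡ m
  eq = m+[n∸m]≡n (≤-trans (m≤m+n _ i) i≤m)

InLeft-inˡ⁻ : ∀ {l r i j} → j < size l → InLeft (node l r) i j → InLeft l i j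
InLeft-inˡ⁻ j< (inˡ h)         = h
InLeft-inˡ⁻ j< (root _)        = ⊥-elim (<-irrefl refl j<)
InLeft-inˡ⁻ {l} j< (inʳ _) = ⊥-elim (m+n≮m _ _ (<-trans (n<1+n _) j<))

InLeft-inʳ⁻ : ∀ {l r i j} → InLeft (node l r) (suc (size l) + i) (suc (size l) + j) → InLeft r i j
InLeft-inʳ⁻ {l} {r} {i} {j} h = go h refl refl
  where
  go : ∀ {x y} → InLeft (node l r) x y → x ≡ suc (size l) + i → y ≡ suc (size l) + j → InLeft r i j
  go (inˡ h) refl refl = ⊥-elim (m+n≮m _ _ (<-trans (n<1+n _) (InLeft-bound h)))
  go (root h) refl _   = ⊥-elim (m+n≮m _ _ (<-trans (n<1+n _) h))
  go (inʳ h) eq eq′    = subst₂ (InLeft r) (+-cancelˡ-≡ (suc (size l)) _ _ eq)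
                                           (+-cancelˡ-≡ (suc (size l)) _ _ eq′) h

⟶-size : ∀ {s t} → s ⟶ t → size s ≡ size t
⟶-size (rot {A} {B} {C}) = cong suc (trans (cong suc (+-assoc (size A) (size B) (size C)))
                                           (sym (+-suc (size A) (size B + size C))))
⟶-size (left {t = t} h)  = cong (λ n → suc (n + size t)) (⟶-size h)
⟶-size (right {s} h)     = cong (λ n → suc (size s + n)) (⟶-size h)

≤T-size : ∀ {s t} → s ≤T t → size s ≡ size t
≤T-size ε        = refl
≤T-size (h ◅ hs) = trans (⟶-size h) (≤T-size hs)

-- A rotation only removes pairs: the nodes of `A` and the root joining `A` to `B` leave the left
-- subtree of the node joined to `C`, and all other pairs stay.
⟶-InLeft : ∀ {s t} → s ⟶ t → ∀ {i j} → InLeft t i j → InLeft s i j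
⟶-InLeft rot (inˡ h)  = inˡ (inˡ h)
⟶-InLeft rot (root h) = inˡ (root h)
⟶-InLeft rot (inʳ (inˡ h)) = inˡ (inʳ h)
⟶-InLeft (rot {A} {B} {C}) (inʳ (root h)) = root (+-monoʳ-< (suc (size A)) h)
⟶-InLeft (rot {A} {B} {C}) (inʳ (inʳ {i = i} {j} h)) =
  subst₂ (InLeft (node (node A B) C)) (eq i) (eq j) (inʳ h)
  where
  eq : ∀ k → suc (size (node A B)) + k ≡ suc (size A) + (suc (size B) + k)
  eq k = trans (cong (_+ k) (cong suc (sym (+-suc (size A) (size B)))))
               (cong suc (+-assoc (size A) (suc (size B)) k))
⟶-InLeft (left h) (inˡ k) = inˡ (⟶-InLeft h k)
⟶-InLeft (left {s} {s'} {t} h) (root k) =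
  subst (InLeft (node s t) _) (⟶-size h) (root (subst (_ <_) (sym (⟶-size h)) k))
⟶-InLeft (left {s} {s'} {t} h) (inʳ {i = i} {j} k) =
  subst (λ n → InLeft (node s t) (suc n + i) (suc n + j)) (⟶-size h) (inʳ k)
⟶-InLeft (right h) (inˡ k)  = inˡ k
⟶-InLeft (right h) (root k) = root k
⟶-InLeft (right h) (inʳ k)  = inʳ (⟶-InLeft h k)

≤T⇒InLeft : ∀ {s t} → s ≤T t → ∀ {i j} → InLeft t i j → InLeft s i j
≤T⇒InLeft ε        k = k
≤T⇒InLeft (h ◅ hs) k = ⟶-InLeft h (≤T⇒InLeft hs k)

node-mono : ∀ {s s' t t'} → s ≤T s' → t ≤T t' → node s t ≤T node s' t'
node-mono {s' = s'} {t} hs ht = gmap (λ x → node x t) left hs ◅◅ gmap (node s') right ht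

-- If every node before k lies in the left subtree of k, then k is on the left
-- spine of s, and rotations bring it to the root.
rotate-to-root : ∀ s k → k < size s → (∀ {i} → i < k → InLeft s i k) →
  ∃₂ λ x y → size x ≡ k × s ≤T node x y
    × (∀ {i j} → j < k → InLeft s i j → InLeft x i j)
    × (∀ {i j} → InLeft s (suc k + i) (suc k + j) → InLeft y i j)
rotate-to-root (node a b) k k< all with <-cmp k (size a)
... | tri≈ _ refl _ = a , b , refl , ε , InLeft-inˡ⁻ , InLeft-inʳ⁻
-- The root `size a` comes before `k` but lies in no left subtree, so `all` fails for it.
... | tri> _ _ a<k = ⊥-elim (absurd (all a<k) refl)
  where
  absurd : ∀ {i j} → InLeft (node a b) i j → i ≡ size a → _
  absurd (inˡ h) refl  = <-irrefl refl (InLeft-boundˡ h)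
  absurd (root h) refl = <-irrefl refl h
  absurd (inʳ h) eq    = m+1+n≢m _ (trans (+-suc (size a) _) eq)
... | tri< k<a _ _ with rotate-to-root a k k<a (λ i<k → InLeft-inˡ⁻ k<a (all i<k))
-- The left subtree has become `node x y`, so a single rotation lifts `k` from the root of that
-- subtree to the root of the whole tree.
... | x , y , sx , a≤ , resˡ , resʳ =
  x , node y b , sx , (gmap (λ z → node z b) left a≤ ◅◅ (rot ◅ ε)) ,
  (λ j<k h → resˡ j<k (InLeft-inˡ⁻ (<-trans j<k k<a) h)) , λ h → new h refl refl
  where
  size-a : size a ≡ suc k + size y
  size-a = trans (≤T-size a≤) (cong (λ n → suc (n + size y)) sx)
  shift : ∀ n → suc (size a) + n ≡ suc k + (suc (size y) + n)
  shift n = trans (cong (λ m → suc (m + n)) size-a)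
           (trans (cong (λ m → suc (suc m)) (+-assoc k (size y) n))
                  (cong suc (sym (+-suc k (size y + n)))))
  new : ∀ {i j i′ j′} → InLeft (node a b) i′ j′ → i′ ≡ suc k + i → j′ ≡ suc k + j → InLeft (node y b) i j
  new (inˡ h) refl refl = inˡ (resʳ h)
  new {j = j} (root h) refl eq = subst (InLeft (node y b) _) y≡j (root (+-cancelˡ-< (suc k) _ _ (subst (_ <_) size-a h)))
    where
    y≡j : size y ≡ j
    y≡j = +-cancelˡ-≡ (suc k) _ _ (trans (sym size-a) eq)
  new (inʳ {i = i₀} {j₀} h) eq eq′ =
    subst₂ (InLeft (node y b)) (+-cancelˡ-≡ (suc k) _ _ (trans (sym (shift i₀)) eq))
                               (+-cancelˡ-≡ (suc k) _ _ (trans (sym (shift j₀)) eq′)) (inʳ h)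

-- Induction on `t`. Every node before the root of `t` lies in its left subtree, hence by hypothesis
-- also in the left subtree of the same node of `s`. That node can therefore be rotated to the root,
-- and both subtrees of the result inherit the hypothesis.
InLeft⇒≤T : ∀ s t → size s ≡ size t → (∀ {i j} → InLeft t i j → InLeft s i j) → s ≤T t
InLeft⇒≤T leaf leaf _ _ = ε
InLeft⇒≤T s (node l r) eq sub
  with rotate-to-root s (size l) (subst (size l <_) (sym eq) (s≤s (m≤m+n _ _))) (λ h → sub (root h))
... | x , y , sx , s≤ , resˡ , resʳ =
  s≤ ◅◅ node-mono (InLeft⇒≤T x l sx (λ h → resˡ (InLeft-bound h) (sub (inˡ h))))
                  (InLeft⇒≤T y r sy (λ h → resʳ (sub (inʳ h))))
  where
  sy : size y ≡ size r
  sy = +-cancelˡ-≡ (suc (size l)) _ _ (trans (cong (λ n → suc (n + size y)) (sym sx)) (trans (sym (≤T-size s≤)) eq))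

-- The number of pairs `(i , j)` with `InLeft t i j`, as the sum of the sizes of all left subtrees.
-- Every rotation lowers it, which gives antisymmetry of `_≤T_`.
weight : BT → ℕ
weight leaf       = 0
weight (node l r) = size l + (weight l + weight r)

⟶-weight : ∀ {s t} → s ⟶ t → weight t < weight s
⟶-weight (rot {A} {B} {C}) = rot-weight (size A) (size B) (weight A) (weight B) (weight C)
  where
  eq : ∀ a b u v w → suc (a + b) + ((a + (u + v)) + w) ≡ suc a + (a + (u + (b + (v + w))))
  eq = ℕ-Solver.solve-∀
  rot-weight : ∀ a b u v w → a + (u + (b + (v + w))) < suc (a + b) + ((a + (u + v)) + w)
  rot-weight a b u v w = subst (a + (u + (b + (v + w))) <_) (sym (eq a b u v w)) (s≤s (m≤n+m _ a))
⟶-weight (left {s} {s'} {t} h) = subst (λ n → n + (weight s' + weight t) < weight (node s t)) (⟶-size h)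
  (+-monoʳ-< (size s) (+-monoˡ-< (weight t) (⟶-weight h)))
⟶-weight (right {s} h) = +-monoʳ-< (size s) (+-monoʳ-< (weight s) (⟶-weight h))

≤T-weight : ∀ {s t} → s ≤T t → weight t ≤ weight s
≤T-weight ε        = ≤-refl
≤T-weight (h ◅ hs) = ≤-trans (≤T-weight hs) (<⇒≤ (⟶-weight h))

≤T-antisym : ∀ {s t} → s ≤T t → t ≤T s → s ≡ t
≤T-antisym ε _         = refl
≤T-antisym (h ◅ hs) ge = ⊥-elim (<-irrefl refl (<-≤-trans (≤-<-trans (≤T-weight hs) (⟶-weight h)) (≤T-weight ge)))

-- Places all nodes of y after those of x in inorder without putting any node
-- of x in the left subtree of a node of y.
graft : BT → BT → BT
graft leaf y       = y
graft (node l r) y = node l (graft r y)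

graft-size : ∀ x y → size (graft x y) ≡ size x + size y
graft-size leaf y       = refl
graft-size (node l r) y = cong suc (trans (cong (size l +_) (graft-size r y)) (sym (+-assoc (size l) _ _)))

graft-inˡ : ∀ {x y i j} → InLeft x i j → InLeft (graft x y) i j
graft-inˡ (inˡ h)  = inˡ h
graft-inˡ (root h) = root h
graft-inˡ (inʳ h)  = inʳ (graft-inˡ h)

graft-inʳ : ∀ x {y i j} → InLeft y i j → InLeft (graft x y) (size x + i) (size x + j)
graft-inʳ leaf h = h
graft-inʳ (node l r) {y} {i} {j} h =
  subst₂ (InLeft (node l (graft r y))) (cong suc (sym (+-assoc (size l) (size r) i)))
         (cong suc (sym (+-assoc (size l) (size r) j))) (inʳ (graft-inʳ r h))

graft-inv : ∀ x {y i j} → InLeft (graft x y) i j →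
  InLeft x i j ⊎ (∃₂ λ i′ j′ → i ≡ size x + i′ × j ≡ size x + j′ × InLeft y i′ j′)
graft-inv leaf h = inj₂ (_ , _ , refl , refl , h)
graft-inv (node l r) (inˡ h) = inj₁ (inˡ h)
graft-inv (node l r) (root h) = inj₁ (root h)
graft-inv (node l r) (inʳ h) with graft-inv r h
... | inj₁ k = inj₁ (inʳ k)
... | inj₂ (i′ , j′ , refl , refl , k) =
  inj₂ (i′ , j′ , cong suc (sym (+-assoc (size l) _ _)) , cong suc (sym (+-assoc (size l) _ _)) , k)

-- Restriction of a tree to some of its nodes

StrictlyIncreasing : ℕ → (ℕ → ℕ) → Set
StrictlyIncreasing m e = ∀ {a b} → a < b → b < m → e a < e b

-- As `e` increases, the indices with values below `c` form an initial segment, of length `k`. With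
-- `c` the root of a tree, these are the indices that belong to its left subtree.
split-at : ∀ m (e : ℕ → ℕ) → StrictlyIncreasing m e → ∀ c →
  ∃₂ λ k k′ → k + k′ ≡ m × (∀ {a} → a < k → e a < c) × (∀ {a} → k ≤ a → a < m → c ≤ e a)
split-at zero e mono c = 0 , 0 , refl , (λ ()) , λ _ ()
split-at (suc m) e mono c with split-at m e (λ a<b b<m → mono a<b (m<n⇒m<1+n b<m)) c
... | k , suc k′ , refl , lo , hi = k , suc (suc k′) , +-suc k (suc k′) , lo , hi′
  where
  hi′ : ∀ {a} → k ≤ a → a < suc (k + suc k′) → c ≤ e a
  hi′ {a} k≤a (s≤s a≤m) with m≤n⇒m<n∨m≡n a≤m
  ... | inj₁ a<m  = hi k≤a a<m
  ... | inj₂ refl = ≤-trans (hi ≤-refl k<) (<⇒≤ (mono k< ≤-refl))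
    where
    k< : k < k + suc k′
    k< = m<m+n k (s≤s z≤n)
... | k , zero , eq , lo , hi with trans (sym (+-identityʳ k)) eq
... | refl with c ≤? e k
... | yes c≤ = k , 1 , +-comm k 1 , lo , λ k≤a a<m → subst (λ a → c ≤ e a) (≤-antisym k≤a (≤-pred a<m)) c≤
... | no c≰ = suc k , 0 , +-identityʳ _ , lo′ , λ k<a a<m → ⊥-elim (<⇒≱ a<m k<a)
  where
  lo′ : ∀ {a} → a < suc k → e a < c
  lo′ (s≤s a≤k) with m≤n⇒m<n∨m≡n a≤k
  ... | inj₁ a<k  = lo a<k
  ... | inj₂ refl = ≰⇒> c≰

-- What remains of `r` when only the nodes `e 0`, ..., `e (m - 1)` are kept: the left-subtree
-- relation is pulled back along `e`.
Restriction : BT → ℕ → (ℕ → ℕ) → BT → Set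
Restriction r m e u = size u ≡ m
  × (∀ {a b} → InLeft u a b → InLeft r (e a) (e b))
  × (∀ {a b} → a < m → b < m → InLeft r (e a) (e b) → InLeft u a b)

InLeft-rootʳ : ∀ {l r i j} → InLeft (node l r) i j → size l < j → size l < i
InLeft-rootʳ (inˡ h) lt  = ⊥-elim (<-asym lt (InLeft-bound h))
InLeft-rootʳ (root _) lt = ⊥-elim (<-irrefl refl lt)
InLeft-rootʳ (inʳ h) _   = s≤s (m≤m+n _ _)

-- The part of `e` from index `d` on, renumbered so that it selects nodes of the right subtree `r`.
-- Here `d` stands for the number of nodes kept in the left subtree, plus one if the root is kept.
-- By `above`, the subtraction in `shifted` does not truncate below index `n`.
module Shift {m d n : ℕ} {e : ℕ → ℕ} (d+n≡m : d + n ≡ m) (mono : StrictlyIncreasing m e)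
             (l r : BT) (bound : ∀ {a} → a < m → e a < size (node l r))
             (above : ∀ {a} → d ≤ a → a < m → size l < e a) where

  shifted : ℕ → ℕ
  shifted a = e (d + a) ∸ suc (size l)

  d+-< : ∀ {a} → a < n → d + a < m
  d+-< a<n = subst (_ <_) d+n≡m (+-monoʳ-< d a<n)

  shifted-eq : ∀ {a} → a < n → suc (size l) + shifted a ≡ e (d + a)
  shifted-eq a<n = m+[n∸m]≡n (above (m≤m+n d _) (d+-< a<n))

  shifted-mono : StrictlyIncreasing n shifted
  shifted-mono a<b b<n = +-cancelˡ-< (suc (size l)) _ _
    (subst₂ _<_ (sym (shifted-eq (<-trans a<b b<n))) (sym (shifted-eq b<n)) (mono (+-monoʳ-< d a<b) (d+-< b<n)))

  shifted-bound : ∀ {a} → a < n → shifted a < size r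
  shifted-bound a<n = +-cancelˡ-< (suc (size l)) _ _ (subst (_< size (node l r)) (sym (shifted-eq a<n)) (bound (d+-< a<n)))

  module _ {v : BT} (res : Restriction r n shifted v) where

    forth : ∀ {a b} → InLeft v a b → InLeft (node l r) (e (d + a)) (e (d + b))
    forth h = subst₂ (InLeft (node l r)) (shifted-eq (subst (_ <_) (proj₁ res) (InLeft-boundˡ h)))
                                         (shifted-eq (subst (_ <_) (proj₁ res) (InLeft-bound h)))
                                         (inʳ (proj₁ (proj₂ res) h))

    back : ∀ {a b} → d ≤ a → d ≤ b → a < m → b < m → InLeft (node l r) (e a) (e b) →
           ∃₂ λ a′ b′ → d + a′ ≡ a × d + b′ ≡ b × InLeft v a′ b′
    back {a} {b} d≤a d≤b a<m b<m h =
      a ∸ d , b ∸ d , m+[n∸m]≡n d≤a , m+[n∸m]≡n d≤b ,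
      proj₂ (proj₂ res) (lt d≤a a<m) (lt d≤b b<m)
        (InLeft-inʳ⁻ (subst₂ (InLeft (node l r)) (eq d≤a a<m) (eq d≤b b<m) h))
      where
      lt : ∀ {a} → d ≤ a → a < m → a ∸ d < n
      lt d≤a a<m = +-cancelˡ-< d _ _ (subst₂ _<_ (sym (m+[n∸m]≡n d≤a)) (sym d+n≡m) a<m)
      eq : ∀ {a} → d ≤ a → a < m → e a ≡ suc (size l) + shifted (a ∸ d)
      eq d≤a a<m = trans (cong e (sym (m+[n∸m]≡n d≤a))) (sym (shifted-eq (lt d≤a a<m)))

-- Recursion on `r`: the left and right subtrees restrict to `x` and `y`. If the root is kept, it
-- joins them as `node x y`. If it is dropped, no node of `x` may lie in the left subtree of a node
-- of `y`, which is what `graft x y` provides.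
restrict : ∀ r m e → StrictlyIncreasing m e → (∀ {a} → a < m → e a < size r) → ∃ (Restriction r m e)
restrict leaf zero e mono bound = leaf , refl , (λ ()) , λ ()
restrict leaf (suc m) e mono bound = ⊥-elim (n≮0 (bound {0} (s≤s z≤n)))
restrict (node l r) m e mono bound with split-at m e mono (size l)
... | k , k′ , eq , lo , hi with restrict l k e (λ a<b b<k → mono a<b (<-≤-trans b<k (subst (k ≤_) eq (m≤m+n k k′)))) lo
... | x , refl , forthˡ , backˡ = cases k′ eq
  where
  backˡ′ : ∀ {a b} → a < m → b < size x → InLeft (node l r) (e a) (e b) → InLeft x a b
  backˡ′ {a} {b} a<m b<k h = backˡ a<k b<k (InLeft-inˡ⁻ (lo b<k) h)
    where
    a<k : a < size x
    a<k = ≰⇒> (λ k≤a → <⇒≱ (<-trans (InLeft-< h) (lo b<k)) (hi k≤a a<m))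

  skip-root : ∀ {k″} → size x + k″ ≡ m → (∀ {a} → size x ≤ a → a < m → size l < e a) →
              ∃ (Restriction (node l r) m e)
  skip-root {k″} eq above with restrict r k″ (Shift.shifted eq mono l r bound above)
                                 (Shift.shifted-mono eq mono l r bound above)
                                 (Shift.shifted-bound eq mono l r bound above)
  ... | y , res = graft x y , trans (graft-size x y) (trans (cong (size x +_) (proj₁ res)) eq) , fwd , bwd
    where
    open Shift eq mono l r bound above
    fwd : ∀ {a b} → InLeft (graft x y) a b → InLeft (node l r) (e a) (e b)
    fwd h with graft-inv x h
    ... | inj₁ h′ = inˡ (forthˡ h′)
    ... | inj₂ (_ , _ , refl , refl , h′) = forth res h′
    bwd : ∀ {a b} → a < m → b < m → InLeft (node l r) (e a) (e b) → InLeft (graft x y) a b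
    bwd {a} {b} a<m b<m h with size x ≤? b
    ... | no k≰b = graft-inˡ (backˡ′ a<m (≰⇒> k≰b) h)
    ... | yes k≤b with size x ≤? a
    ... | no k≰a = ⊥-elim (<-asym (lo (≰⇒> k≰a)) (InLeft-rootʳ h (above k≤b b<m)))
    ... | yes k≤a with back res k≤a k≤b a<m b<m h
    ... | _ , _ , refl , refl , h′ = graft-inʳ x h′

  keep-root : ∀ {k″} → suc (size x) + k″ ≡ m → e (size x) ≡ size l → ∃ (Restriction (node l r) m e)
  keep-root {k″} eq ek = go
    where
    above : ∀ {a} → suc (size x) ≤ a → a < m → size l < e a
    above k<a a<m = subst (_< e _) ek (mono k<a a<m)
    open Shift eq mono l r bound above
    go : ∃ (Restriction (node l r) m e)
    go with restrict r k″ shifted shifted-mono shifted-bound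
    ... | y , res = node x y , trans (cong (suc (size x) +_) (proj₁ res)) eq , fwd , bwd
      where
      fwd : ∀ {a b} → InLeft (node x y) a b → InLeft (node l r) (e a) (e b)
      fwd (inˡ h) = inˡ (forthˡ h)
      fwd (root h) = subst (InLeft (node l r) _) (sym ek) (root (lo h))
      fwd (inʳ h) = forth res h
      bwd : ∀ {a b} → a < m → b < m → InLeft (node l r) (e a) (e b) → InLeft (node x y) a b
      bwd {a} {b} a<m b<m h with <-cmp b (size x)
      ... | tri< b<k _ _ = inˡ (backˡ′ a<m b<k h)
      ... | tri≈ _ refl _ = root (≰⇒> (λ k≤a → <⇒≱ (subst (e a <_) ek (InLeft-< h)) (hi k≤a a<m)))
      ... | tri> _ _ k<b with <-cmp a (size x)
      ... | tri< a<k _ _ = ⊥-elim (<-asym (lo a<k) (InLeft-rootʳ h (above k<b b<m)))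
      ... | tri≈ _ refl _ = ⊥-elim (<-irrefl (sym ek) (InLeft-rootʳ h (above k<b b<m)))
      ... | tri> _ _ k<a with back res k<a k<b a<m b<m h
      ... | _ , _ , refl , refl , h′ = inʳ h′

  cases : ∀ k′ → size x + k′ ≡ m → ∃ (Restriction (node l r) m e)
  cases zero eq = skip-root eq λ k≤a a<m → ⊥-elim (<⇒≱ a<m (subst (_≤ _) (trans (sym (+-identityʳ _)) eq) k≤a))
  -- `size x` is the first index that `e` does not send to the left of the root, so the root is kept
  -- iff `e` sends this index to it.
  cases (suc k″) eq with m≤n⇒m<n∨m≡n (hi ≤-refl (subst (size x <_) eq (m<m+n _ (s≤s z≤n))))
  ... | inj₂ ek = keep-root (trans (sym (+-suc (size x) k″)) eq) (sym ek)
  ... | inj₁ lt = skip-root eq above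
    where
    above : ∀ {a} → size x ≤ a → a < m → size l < e a
    above k≤a a<m with m≤n⇒m<n∨m≡n k≤a
    ... | inj₁ k<a  = <-trans lt (mono k<a a<m)
    ... | inj₂ refl = lt

-- Decreasing trees of words

nth : Perm → ℕ → ℕ
nth w i = at w (suc i)

nth-++ˡ : ∀ xs {ys i} → i < length xs → nth (xs ++ ys) i ≡ nth xs i
nth-++ˡ (x ∷ xs) {i = zero}  _        = refl
nth-++ˡ (x ∷ xs) {i = suc i} (s≤s i<) = nth-++ˡ xs i<

nth-++ʳ : ∀ xs {ys i} → nth (xs ++ ys) (length xs + i) ≡ nth ys i
nth-++ʳ []       = refl
nth-++ʳ (x ∷ xs) = nth-++ʳ xs

nth-++-mid : ∀ xs {y ys} → nth (xs ++ y ∷ ys) (length xs) ≡ y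
nth-++-mid []       = refl
nth-++-mid (x ∷ xs) = nth-++-mid xs

nth-++-tail : ∀ xs {y ys i} → nth (xs ++ y ∷ ys) (suc (length xs) + i) ≡ nth ys i
nth-++-tail []       = refl
nth-++-tail (x ∷ xs) = nth-++-tail xs

nth-map : ∀ (g : ℕ → ℕ) xs {i} → i < length xs → nth (map g xs) i ≡ g (nth xs i)
nth-map g (x ∷ xs) {zero}  _        = refl
nth-map g (x ∷ xs) {suc i} (s≤s i<) = nth-map g xs i<

nth-∈ : ∀ {xs i} → i < length xs → nth xs i ∈ xs
nth-∈ {x ∷ xs} {zero}  _        = here refl
nth-∈ {x ∷ xs} {suc i} (s≤s i<) = there (nth-∈ i<)

∈⇒nth : ∀ {x xs} → x ∈ xs → ∃ λ i → i < length xs × nth xs i ≡ x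
∈⇒nth (here refl) = 0 , s≤s z≤n , refl
∈⇒nth (there x∈) with ∈⇒nth x∈
... | i , i< , eq = suc i , s≤s i< , eq

nth-ext : ∀ {xs ys} → length xs ≡ length ys → (∀ {i} → i < length xs → nth xs i ≡ nth ys i) → xs ≡ ys
nth-ext {[]} {[]} _ _ = refl
nth-ext {x ∷ xs} {y ∷ ys} eq h =
  cong₂ _∷_ (h {0} (s≤s z≤n)) (nth-ext (suc-injective eq) (λ i< → h (s≤s i<)))

Unique-++⁻ : ∀ {A : Set} (xs : List A) {ys} → Unique (xs ++ ys) → Unique xs × Unique ys
Unique-++⁻ [] u = [] , u
Unique-++⁻ (x ∷ xs) (x∉ ∷ u) with Unique-++⁻ xs u
... | uxs , uys = All.++⁻ˡ xs x∉ ∷ uxs , uys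

Unique-map-on : ∀ {A B : Set} (g : A → B) {xs} → (∀ {x y} → x ∈ xs → y ∈ xs → g x ≡ g y → x ≡ y) →
                Unique xs → Unique (map g xs)
Unique-map-on g inj []       = []
Unique-map-on g inj (x∉ ∷ u) =
  All.map⁺ (All.tabulate λ y∈ eq → All.lookup x∉ y∈ (inj (here refl) (there y∈) eq))
  ∷ Unique-map-on g (λ x∈ y∈ → inj (there x∈) (there y∈)) u

count-mono : ∀ {A : Set} {P Q : A → Set} (P? : ∀ x → Dec (P x)) (Q? : ∀ x → Dec (Q x)) →
             (∀ {x} → P x → Q x) → ∀ xs → count P? xs ≤ count Q? xs
count-mono P? Q? P⇒Q [] = z≤n
count-mono P? Q? P⇒Q (x ∷ xs) with P? x | Q? x
... | yes p | yes q = s≤s (count-mono P? Q? P⇒Q xs)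
... | yes p | no ¬q = contradiction (P⇒Q p) ¬q
... | no ¬p | yes q = m≤n⇒m≤1+n (count-mono P? Q? P⇒Q xs)
... | no ¬p | no ¬q = count-mono P? Q? P⇒Q xs

count-strict : ∀ {A : Set} {P Q : A → Set} (P? : ∀ x → Dec (P x)) (Q? : ∀ x → Dec (Q x)) →
               (∀ {x} → P x → Q x) → ∀ {x xs} → x ∈ xs → ¬ P x → Q x → count P? xs < count Q? xs
count-strict P? Q? P⇒Q {xs = x ∷ xs} (here refl) ¬p q with P? x | Q? x
... | yes p | _     = contradiction p ¬p
... | no _  | no ¬q = contradiction q ¬q
... | no _  | yes _ = s≤s (count-mono P? Q? P⇒Q xs)
count-strict P? Q? P⇒Q {xs = y ∷ xs} (there x∈) ¬p q with P? y | Q? y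
... | yes p′ | yes q′ = s≤s (count-strict P? Q? P⇒Q x∈ ¬p q)
... | yes p′ | no ¬q  = contradiction (P⇒Q p′) ¬q
... | no _   | yes _  = m<n⇒m<1+n (count-strict P? Q? P⇒Q x∈ ¬p q)
... | no _   | no _   = count-strict P? Q? P⇒Q x∈ ¬p q

-- In the decreasing tree of `w`, position `i` lies in the left subtree of `j` iff the letter at `j`
-- exceeds all letters at positions from `i` to `j - 1`. The forward half mentions only the letter
-- at `i`, since `InLeft-interval` supplies the others.
IsDecreasingTree : Perm → BT → Set
IsDecreasingTree w u = size u ≡ length w
  × (∀ {i j} → InLeft u i j → nth w i < nth w j)
  × (∀ {i j} → i < j → j < length w → (∀ {m} → i ≤ m → m < j → nth w m < nth w j) → InLeft u i j)

IsDecreasingTree-node : ∀ {l x r u v} → All (_< x) l → All (_< x) r →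
  IsDecreasingTree l u → IsDecreasingTree r v → IsDecreasingTree (l ++ x ∷ r) (node u v)
IsDecreasingTree-node {l} {x} {r} {u} {v} l<x r<x (su , fu , bu) (sv , fv , bv) = sz , fwd , bwd
  where
  w = l ++ x ∷ r
  sz : size (node u v) ≡ length w
  sz = trans (cong suc (cong₂ _+_ su sv)) (trans (sym (+-suc (length l) (length r))) (sym (List.length-++ l)))
  atˡ : ∀ {i} → i < length l → nth w i ≡ nth l i
  atˡ = nth-++ˡ l
  at-root : nth w (size u) ≡ x
  at-root = trans (cong (nth w) su) (nth-++-mid l)
  atʳ : ∀ i → nth w (suc (size u) + i) ≡ nth r i
  atʳ i = trans (cong (λ n → nth w (suc n + i)) su) (nth-++-tail l)
  fwd : ∀ {i j} → InLeft (node u v) i j → nth w i < nth w j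
  fwd (inˡ h) = subst₂ _<_ (sym (atˡ (subst (_ <_) su (InLeft-boundˡ h))))
                           (sym (atˡ (subst (_ <_) su (InLeft-bound h)))) (fu h)
  fwd (root h) = subst₂ _<_ (sym (atˡ i<)) (sym at-root) (All.lookup l<x (nth-∈ i<))
    where
    i< = subst (_ <_) su h
  fwd (inʳ {i = i} {j} h) = subst₂ _<_ (sym (atʳ i)) (sym (atʳ j)) (fv h)
  bwd : ∀ {i j} → i < j → j < length w → (∀ {m} → i ≤ m → m < j → nth w m < nth w j) → InLeft (node u v) i j
  bwd {i} {j} i<j j<w all with <-cmp j (size u)
  ... | tri< j<u _ _ = inˡ (bu i<j j<l (λ i≤m m<j → subst₂ _<_ (atˡ (<-trans m<j j<l)) (atˡ j<l) (all i≤m m<j)))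
    where
    j<l = subst (j <_) su j<u
  ... | tri≈ _ refl _ = root i<j
  ... | tri> _ _ u<j with m+[n∸m]≡n u<j | i ≤? size u
  -- The root position lies between `i` and `j`, so `all` would put its letter `x` below a letter of
  -- `r`.
  ... | eq | yes i≤u = ⊥-elim (<-asym (subst₂ _<_ at-root (trans (cong (nth w) (sym eq)) (atʳ _)) (all i≤u u<j))
                                       (All.lookup r<x (nth-∈ j′<)))
    where
    j′< : j ∸ suc (size u) < length r
    j′< = subst (_ <_) sv (+-cancelˡ-< (suc (size u)) _ _ (subst₂ _<_ (sym eq) (sym sz) j<w))
  ... | eq | no i≰u with m+[n∸m]≡n (≰⇒> i≰u)
  ... | eq′ = subst₂ (InLeft (node u v)) eq′ eq (inʳ (bv
      (+-cancelˡ-< (suc (size u)) _ _ (subst₂ _<_ (sym eq′) (sym eq) i<j))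
      (subst (_ <_) sv (+-cancelˡ-< (suc (size u)) _ _ (subst₂ _<_ (sym eq) (sym sz) j<w)))
      (λ {m} i≤m m<j → subst₂ _<_ (atʳ m) (trans (cong (nth w) (sym eq)) (atʳ _))
         (all (subst (_≤ suc (size u) + m) eq′ (+-monoʳ-≤ (suc (size u)) i≤m))
              (subst (suc (size u) + m <_) eq (+-monoʳ-< (suc (size u)) m<j))))))

-- Standardization and the map λ

st-rank : List ℕ → ℕ → ℕ
st-rank w x = suc (count (_<? x) w)

st-rank-mono-< : ∀ {w x y} → x ∈ w → x < y → st-rank w x < st-rank w y
st-rank-mono-< x∈ x<y = s≤s (count-strict (_<? _) (_<? _) (λ z<x → <-trans z<x x<y) x∈ (<-irrefl refl) x<y)

st-rank-cancel-< : ∀ {w x y} → y ∈ w → st-rank w x < st-rank w y → x < y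
st-rank-cancel-< {w} {x} {y} y∈ lt with <-cmp x y
... | tri< x<y _ _  = x<y
... | tri≈ _ refl _ = ⊥-elim (<-irrefl refl lt)
... | tri> _ _ y<x  = ⊥-elim (<-asym lt (st-rank-mono-< y∈ y<x))

-- Standardization preserves the relative order of the letters, and `IsDecreasingTree` depends on
-- nothing else.
IsDecreasingTree-st : ∀ {w u} → IsDecreasingTree (st w) u → IsDecreasingTree w u
IsDecreasingTree-st {w} {u} (su , fu , bu) = sz , fwd , bwd
  where
  len : length (st w) ≡ length w
  len = List.length-map (st-rank w) w
  sz = trans su len
  nth-st : ∀ {i} → i < length w → nth (st w) i ≡ st-rank w (nth w i)
  nth-st = nth-map (st-rank w) w
  fwd : ∀ {i j} → InLeft u i j → nth w i < nth w j
  fwd h = st-rank-cancel-< {w} (nth-∈ {w} j<) (subst₂ _<_ (nth-st i<) (nth-st j<) (fu h))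
    where
    i< = subst (_ <_) sz (InLeft-boundˡ h)
    j< = subst (_ <_) sz (InLeft-bound h)
  bwd : ∀ {i j} → i < j → j < length w → (∀ {m} → i ≤ m → m < j → nth w m < nth w j) → InLeft u i j
  bwd i<j j< all = bu i<j (subst (_ <_) (sym len) j<) λ i≤m m<j →
    subst₂ _<_ (sym (nth-st (<-trans m<j j<))) (sym (nth-st j<))
      (st-rank-mono-< {w} (nth-∈ {w} (<-trans m<j j<)) (all i≤m m<j))

-- All that λgo needs of a permutation; unlike being a permutation, it is
-- readily checked for st w.
IsStandard : Perm → Set
IsStandard σ = Unique σ × All (_≤ length σ) σ × (σ ≡ [] ⊎ length σ ∈ σ)

maximum : ∀ x xs → ∃ λ m → m ∈ x ∷ xs × All (_≤ m) (x ∷ xs)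
maximum x [] = x , here refl , ≤-refl ∷ []
maximum x (y ∷ ys) with maximum y ys
... | m , m∈ , all with ≤-total x m
... | inj₁ x≤m = m , there m∈ , x≤m ∷ all
... | inj₂ m≤x = x , here refl , ≤-refl ∷ All.map (λ y≤m → ≤-trans y≤m m≤x) all

-- The count of smaller letters misses only `m` itself, and the `suc` in `st-rank` makes up for it.
st-rank-max : ∀ {w m} → Unique w → m ∈ w → All (_≤ m) w → st-rank w m ≡ length w
st-rank-max {x ∷ xs} {m} (x∉ ∷ u) (here refl) (_ ∷ all) = cong suc (trans
  (cong length (List.filter-reject (_<? m) {xs = xs} (<-irrefl refl)))
  (cong length (List.filter-all (_<? m) (All.zipWith (λ (y≤m , m≢y) → ≤∧≢⇒< y≤m (≢-sym m≢y)) (all , x∉)))))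
st-rank-max {x ∷ xs} {m} (x∉ ∷ u) (there m∈) (x≤m ∷ all) = cong suc (trans
  (cong length (List.filter-accept (_<? m) {xs = xs} (≤∧≢⇒< x≤m (All.lookup x∉ m∈))))
  (st-rank-max u m∈ all))

st-IsStandard : ∀ {w} → Unique w → IsStandard (st w)
st-IsStandard {[]} u = [] , [] , inj₁ refl
st-IsStandard {w@(x ∷ xs)} u with maximum x xs
... | m , m∈ , all = Unique-map-on (st-rank w) inj u , All.map⁺ (All.tabulate bound) ,
  inj₂ (subst (_∈ st w) (trans (st-rank-max u m∈ all) (sym (List.length-map _ w))) (∈-map⁺ (st-rank w) m∈))
  where
  inj : ∀ {x y} → x ∈ w → y ∈ w → st-rank w x ≡ st-rank w y → x ≡ y
  inj {x} {y} x∈ y∈ eq with <-cmp x y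
  ... | tri< x<y _ _  = ⊥-elim (<-irrefl eq (st-rank-mono-< x∈ x<y))
  ... | tri≈ _ x≡y _ = x≡y
  ... | tri> _ _ y<x  = ⊥-elim (<-irrefl (sym eq) (st-rank-mono-< y∈ y<x))
  bound : ∀ {x} → x ∈ w → st-rank w x ≤ length (st w)
  bound {x} x∈ = subst (st-rank w x ≤_) (sym (List.length-map _ w))
    (List.filter-notAll (_<? x) w (Any.map (λ { refl → <-irrefl refl }) x∈))

-- `pos` tests equality by `_≡ᵇ_`, and `break (_≟ n)` reduces to the same test, so both can be
-- computed by rewriting with this lemma and the next.
≡ᵇ-refl : ∀ x → (x ≡ᵇ x) ≡ true
≡ᵇ-refl zero    = refl
≡ᵇ-refl (suc x) = ≡ᵇ-refl x

≢⇒≡ᵇ : ∀ {x y} → x ≢ y → (x ≡ᵇ y) ≡ false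
≢⇒≡ᵇ {zero}  {zero}  ne = contradiction refl ne
≢⇒≡ᵇ {zero}  {suc y} ne = refl
≢⇒≡ᵇ {suc x} {zero}  ne = refl
≢⇒≡ᵇ {suc x} {suc y} ne = ≢⇒≡ᵇ (ne ∘ cong suc)

break-at : ∀ {n} l {r} → All (_≢ n) l → break (_≟ n) (l ++ n ∷ r) ≡ (l , n ∷ r)
break-at {n} [] [] rewrite ≡ᵇ-refl n = refl
break-at {n} (x ∷ l) {r} (ne ∷ nes) rewrite ≢⇒≡ᵇ ne | break-at l {r} nes = refl

λgo-node : ∀ k {σ l y r} → break (_≟ length σ) σ ≡ (l , y ∷ r) → λgo (suc k) σ ≡ node (λgo k (st l)) (λgo k (st r))
λgo-node k {x ∷ xs} eq rewrite eq = refl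

leaf-IsDecreasingTree : IsDecreasingTree [] leaf
leaf-IsDecreasingTree = refl , (λ ()) , λ _ ()

-- The largest letter of a nonempty standard word is its length, so `break` at that value splits the
-- word at the root of its decreasing tree; distinctness of the letters keeps the value out of both
-- parts. Each part is shorter than the word, so one unit less of fuel suffices for it.
λgo-IsDecreasingTree : ∀ k σ → length σ ≤ k → IsStandard σ → IsDecreasingTree σ (λgo k σ)
λgo-IsDecreasingTree zero    [] _ _ = leaf-IsDecreasingTree
λgo-IsDecreasingTree (suc k) [] _ _ = leaf-IsDecreasingTree
λgo-IsDecreasingTree (suc k) σ@(_ ∷ _) len (uniq , ≤n , inj₂ n∈) with ∈-∃++ n∈
... | l , r , eq = subst₂ IsDecreasingTree (sym eq) (sym (λgo-node k brk))
    (IsDecreasingTree-node l< r<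
      (IsDecreasingTree-st {l} (λgo-IsDecreasingTree k (st l) (sub-≤ l l-len) (st-IsStandard (proj₁ (Unique-++⁻ l uniq′)))))
      (IsDecreasingTree-st {r} (λgo-IsDecreasingTree k (st r) (sub-≤ r r-len) (st-IsStandard ur))))
  where
  n = length σ
  uniq′ : Unique (l ++ n ∷ r)
  uniq′ = subst Unique eq uniq
  ur : Unique r
  ur with proj₂ (Unique-++⁻ l uniq′)
  ... | _ ∷ u = u
  n∉lr : All (n ≢_) (l ++ r)
  n∉lr with PermSetoid.Unique-resp-↭ (setoid ℕ) (↭⇒↭ₛ (Perm.shift n l r)) uniq′
  ... | n∉ ∷ _ = n∉
  ≤n′ : All (_≤ n) (l ++ n ∷ r)
  ≤n′ = subst (All (_≤ n)) eq ≤n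
  strict : ∀ {xs} → All (_≤ n) xs → All (n ≢_) xs → All (_< n) xs
  strict a b = All.zipWith (λ (y≤n , n≢y) → ≤∧≢⇒< y≤n (≢-sym n≢y)) (a , b)
  l< : All (_< n) l
  l< = strict (All.++⁻ˡ l ≤n′) (All.++⁻ˡ l n∉lr)
  r< : All (_< n) r
  r< = strict (All.tail (All.++⁻ʳ l ≤n′)) (All.++⁻ʳ l n∉lr)
  brk : break (_≟ length σ) σ ≡ (l , n ∷ r)
  brk = subst (λ w → break (_≟ n) w ≡ (l , n ∷ r)) (sym eq) (break-at l (All.map (λ n≢ e → n≢ (sym e)) (All.++⁻ˡ l n∉lr)))
  lens : suc (length l + length r) ≤ suc k
  lens = subst (_≤ suc k) (trans (cong length eq) (trans (List.length-++ l) (+-suc (length l) (length r)))) len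
  l-len : length l ≤ k
  l-len = ≤-trans (m≤m+n _ _) (≤-pred lens)
  r-len : length r ≤ k
  r-len = ≤-trans (m≤n+m _ (length l)) (≤-pred lens)
  sub-≤ : ∀ w → length w ≤ k → length (st w) ≤ k
  sub-≤ w = subst (_≤ k) (sym (List.length-map _ w))

-- Permutations, their composition and inverses

length-range1 : ∀ n → length (range1 n) ≡ n
length-range1 n = trans (List.length-map suc (upTo n)) (List.length-upTo n)

∈-range1⁻ : ∀ {n x} → x ∈ range1 n → 1 ≤ x × x ≤ n
∈-range1⁻ x∈ with ∈-map⁻ suc x∈
... | _ , i∈ , refl = s≤s z≤n , ∈-upTo⁻ i∈

∈-range1⁺ : ∀ {n i} → i < n → suc i ∈ range1 n
∈-range1⁺ i<n = ∈-map⁺ suc (∈-upTo⁺ i<n)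

range1-unique : ∀ n → Unique (range1 n)
range1-unique n = Unique.map⁺ suc-injective (Unique.upTo⁺ n)

range1-suc : ∀ n → range1 (suc n) ≡ range1 n ++ [ suc n ]
range1-suc n = trans (cong (map suc) (sym (List.upTo-∷ʳ n))) (List.map-++ suc (upTo n) [ n ])

range1-+ : ∀ a b → range1 (a + b) ≡ range1 a ++ map (_+ a) (range1 b)
range1-+ a zero = trans (cong range1 (+-identityʳ a)) (sym (List.++-identityʳ (range1 a)))
range1-+ a (suc b) = begin
  range1 (a + suc b)                                           ≡⟨ cong range1 (+-suc a b) ⟩
  range1 (suc (a + b))                                         ≡⟨ range1-suc (a + b) ⟩
  range1 (a + b) ++ [ suc (a + b) ]                            ≡⟨ cong₂ (λ xs n → xs ++ [ suc n ]) (range1-+ a b) (+-comm a b) ⟩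
  (range1 a ++ map (_+ a) (range1 b)) ++ [ suc b + a ]         ≡⟨ List.++-assoc (range1 a) _ _ ⟩
  range1 a ++ (map (_+ a) (range1 b) ++ [ suc b + a ])         ≡⟨ cong (range1 a ++_) (List.map-++ (_+ a) (range1 b) [ suc b ]) ⟨
  range1 a ++ map (_+ a) (range1 b ++ [ suc b ])               ≡⟨ cong (λ xs → range1 a ++ map (_+ a) xs) (range1-suc b) ⟨
  range1 a ++ map (_+ a) (range1 (suc b))                      ∎
  where open ≡-Reasoning

nth-range1 : ∀ {n i} → i < n → nth (range1 n) i ≡ suc i
nth-range1 {suc n} {i} i≤n with m≤n⇒m<n∨m≡n (≤-pred i≤n)
... | inj₁ i<n  = trans (cong (λ w → nth w i) (range1-suc n))
                 (trans (nth-++ˡ (range1 n) (subst (i <_) (sym (length-range1 n)) i<n)) (nth-range1 i<n))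
... | inj₂ refl = trans (cong (λ w → nth w i) (range1-suc n))
                 (trans (cong (nth (range1 n ++ [ suc n ])) (sym (length-range1 n))) (nth-++-mid (range1 n)))

IsPermutation : ℕ → Perm → Set
IsPermutation n σ = σ ↭ range1 n

module _ {n σ} (σ-perm : IsPermutation n σ) where

  perm-length : length σ ≡ n
  perm-length = trans (Perm.↭-length σ-perm) (length-range1 n)

  perm-unique : Unique σ
  perm-unique = PermSetoid.Unique-resp-↭ (setoid ℕ) (↭⇒↭ₛ (↭-sym σ-perm)) (range1-unique n)

  perm-∈⁻ : ∀ {x} → x ∈ σ → 1 ≤ x × x ≤ n
  perm-∈⁻ x∈ = ∈-range1⁻ (Perm.∈-resp-↭ σ-perm x∈)

  perm-∈⁺ : ∀ {i} → i < n → suc i ∈ σ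
  perm-∈⁺ i<n = Perm.∈-resp-↭ (↭-sym σ-perm) (∈-range1⁺ i<n)

  perm-nth : ∀ {i} → i < n → 1 ≤ nth σ i × nth σ i ≤ n
  perm-nth i<n = perm-∈⁻ (nth-∈ (subst (_ <_) (sym perm-length) i<n))

perm-IsStandard : ∀ {n σ} → IsPermutation n σ → IsStandard σ
perm-IsStandard {n} {σ} σ-perm =
  perm-unique σ-perm ,
  All.tabulate (λ x∈ → subst (_ ≤_) (sym (perm-length σ-perm)) (proj₂ (perm-∈⁻ σ-perm x∈))) ,
  nonempty n (perm-length σ-perm) (perm-∈⁺ σ-perm)
  where
  nonempty : ∀ {σ} n → length σ ≡ n → (∀ {i} → i < n → suc i ∈ σ) → σ ≡ [] ⊎ length σ ∈ σ
  nonempty {[]} zero _ _ = inj₁ refl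
  nonempty {σ} (suc n) eq mem = inj₂ (subst (_∈ σ) (sym eq) (mem ≤-refl))

/-perm : ∀ {p q σ τ} → IsPermutation p σ → IsPermutation q τ → IsPermutation (p + q) (σ / τ)
/-perm {p} {q} {σ} {τ} hσ hτ = ↭-trans
  (Perm.++⁺ hσ (↭-trans (↭-reflexive (cong (λ n → map (_+ n) τ) (perm-length hσ))) (Perm.map⁺ (_+ p) hτ)))
  (↭-reflexive (sym (range1-+ p q)))

-- Up to order, `σ ∨ τ` consists of the letters of `τ / σ` and one new largest letter.
∨-perm : ∀ {p q σ τ} → IsPermutation p σ → IsPermutation q τ → IsPermutation (suc (p + q)) (σ ∨ τ)
∨-perm {p} {q} {σ} {τ} hσ hτ =
  ↭-trans (Perm.shift _ (map (_+ length τ) σ) τ)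
  (↭-trans (prep _ (↭-trans (Perm.++-comm (map (_+ length τ) σ) τ) (/-perm hτ hσ)))
  (↭-trans (Perm.∷↭∷ʳ _ (range1 (q + p)))
  (↭-reflexive (trans (cong (λ n → range1 (q + p) ++ [ n ]) top)
                      (trans (sym (range1-suc (q + p))) (cong (λ n → range1 (suc n)) (+-comm q p)))))))
  where
  top : length σ + length τ + 1 ≡ suc (q + p)
  top = trans (+-comm _ 1) (cong suc (trans (cong₂ _+_ (perm-length hσ) (perm-length hτ)) (+-comm p q)))

γ-perm : ∀ s → IsPermutation (size s) (γ s)
γ-perm leaf       = ↭-refl
γ-perm (node l r) = ∨-perm (γ-perm l) (γ-perm r)

pos-nth : ∀ {ζ i} → Unique ζ → i < length ζ → pos ζ (nth ζ i) ≡ suc i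
pos-nth {x ∷ xs} {zero} u i< rewrite ≡ᵇ-refl x = refl
pos-nth {x ∷ xs} {suc i} (x∉ ∷ u) (s≤s i<) rewrite ≢⇒≡ᵇ (All.lookup x∉ (nth-∈ i<)) = cong suc (pos-nth u i<)

map-pos : ∀ {ζ} → Unique ζ → map (pos ζ) ζ ≡ range1 (length ζ)
map-pos {ζ} u = nth-ext (trans (List.length-map (pos ζ) ζ) (sym (length-range1 (length ζ)))) λ i< →
  let i<′ = subst (_ <_) (List.length-map (pos ζ) ζ) i< in
  trans (nth-map (pos ζ) ζ i<′) (trans (pos-nth u i<′) (sym (nth-range1 i<′)))

map-at-range1 : ∀ π → map (at π) (range1 (length π)) ≡ π
map-at-range1 π = nth-ext len λ i< →
  let i<′ = subst (_ <_) len i< in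
  trans (nth-map (at π) (range1 (length π)) (subst (_ <_) (sym (length-range1 _)) i<′)) (cong (at π) (nth-range1 i<′))
  where
  len : length (map (at π) (range1 (length π))) ≡ length π
  len = trans (List.length-map (at π) (range1 (length π))) (length-range1 (length π))

-- As `ζ` is a rearrangement of `range1 n`, `inv ζ` is one of `map (pos ζ) ζ`, which lists the
-- places in order.
inv-perm : ∀ {n ζ} → IsPermutation n ζ → IsPermutation n (inv ζ)
inv-perm {n} {ζ} ζ-perm = ↭-trans
  (Perm.map⁺ (pos ζ) (↭-trans (↭-reflexive (cong range1 (perm-length ζ-perm))) (↭-sym ζ-perm)))
  (↭-reflexive (trans (map-pos (perm-unique ζ-perm)) (cong range1 (perm-length ζ-perm))))

·-perm : ∀ {n π ζ} → IsPermutation n π → IsPermutation n ζ → IsPermutation n (π · ζ)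
·-perm {n} {π} {ζ} π-perm ζ-perm = ↭-trans (Perm.map⁺ (at π) ζ-perm)
  (↭-trans (↭-reflexive (trans (cong (λ n → map (at π) (range1 n)) (sym (perm-length π-perm))) (map-at-range1 π))) π-perm)

-- 0-based counterpart of ζ(a + 1): the place of the (a + 1)-st letter of π in
-- the word π · ζ⁻¹.
place : Perm → ℕ → ℕ
place ζ a = pred (nth ζ a)

module Places {n ζ} (ζ-perm : IsPermutation n ζ) where

  suc-place : ∀ {a} → a < n → suc (place ζ a) ≡ nth ζ a
  suc-place a<n = m+[n∸m]≡n (proj₁ (perm-nth ζ-perm a<n))

  place-< : ∀ {a} → a < n → place ζ a < n
  place-< a<n = subst (_≤ n) (sym (suc-place a<n)) (proj₂ (perm-nth ζ-perm a<n))

  place-surjective : ∀ {i} → i < n → ∃ λ a → a < n × place ζ a ≡ i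
  place-surjective i<n with ∈⇒nth (perm-∈⁺ ζ-perm i<n)
  ... | a , a< , eq = a , subst (a <_) (perm-length ζ-perm) a< , cong pred eq

  -- Since ζ⁻¹(ζ(a)) = a, multiplying by ζ⁻¹ on the right moves each letter of `π` to the place that
  -- `ζ` assigns to its index.
  nth-·-inv : ∀ π {a} → a < n → nth (π · inv ζ) (place ζ a) ≡ nth π a
  nth-·-inv π {a} a<n = begin
    nth (π · inv ζ) (place ζ a)                     ≡⟨ nth-map (at π) (inv ζ) (subst (place ζ a <_) (sym (perm-length (inv-perm ζ-perm))) (place-< a<n)) ⟩
    at π (nth (inv ζ) (place ζ a))                  ≡⟨ cong (at π) (nth-map (pos ζ) (range1 (length ζ)) (subst (place ζ a <_) (sym (length-range1 _)) lt)) ⟩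
    at π (pos ζ (nth (range1 (length ζ)) (place ζ a))) ≡⟨ cong (λ v → at π (pos ζ v)) (trans (nth-range1 lt) (suc-place a<n)) ⟩
    at π (pos ζ (nth ζ a))                          ≡⟨ cong (at π) (pos-nth (perm-unique ζ-perm) (subst (a <_) (sym (perm-length ζ-perm)) a<n)) ⟩
    nth π a                                         ∎
    where
    open ≡-Reasoning
    lt : place ζ a < length ζ
    lt = subst (place ζ a <_) (sym (perm-length ζ-perm)) (place-< a<n)

-- The permutations γ(s)

γ-length : ∀ s → length (γ s) ≡ size s
γ-length s = perm-length (γ-perm s)

module _ (l r : BT) where

  private
    len : length (map (_+ length (γ r)) (γ l)) ≡ size l
    len = trans (List.length-map _ (γ l)) (γ-length l)

  γ-nthˡ : ∀ {a} → a < size l → nth (γ (node l r)) a ≡ nth (γ l) a + size r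
  γ-nthˡ {a} a< = trans (nth-++ˡ (map (_+ length (γ r)) (γ l)) (subst (a <_) (sym len) a<))
    (trans (nth-map _ (γ l) (subst (a <_) (sym (γ-length l)) a<)) (cong (nth (γ l) a +_) (γ-length r)))

  γ-nth-root : nth (γ (node l r)) (size l) ≡ size l + size r + 1
  γ-nth-root = trans (cong (nth (γ (node l r))) (sym len))
    (trans (nth-++-mid (map (_+ length (γ r)) (γ l))) (cong₂ (λ a b → a + b + 1) (γ-length l) (γ-length r)))

  γ-nthʳ : ∀ a → nth (γ (node l r)) (suc (size l) + a) ≡ nth (γ r) a
  γ-nthʳ a = trans (cong (λ n → nth (γ (node l r)) (suc n + a)) (sym len))
    (nth-++-tail (map (_+ length (γ r)) (γ l)))

γ-bound : ∀ s {a} → a < size s → 1 ≤ nth (γ s) a × nth (γ s) a ≤ size s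
γ-bound s = perm-nth (γ-perm s)

InLeft⇒γ-< : ∀ {s a b} → InLeft s a b → nth (γ s) a < nth (γ s) b
InLeft⇒γ-< {node l r} (inˡ h) = subst₂ _<_ (sym (γ-nthˡ l r (InLeft-boundˡ h))) (sym (γ-nthˡ l r (InLeft-bound h)))
  (+-monoˡ-< (size r) (InLeft⇒γ-< h))
InLeft⇒γ-< {node l r} (root h) = subst₂ _<_ (sym (γ-nthˡ l r h)) (sym (trans (γ-nth-root l r) (+-comm _ 1)))
  (s≤s (+-monoˡ-≤ (size r) (proj₂ (γ-bound l h))))
InLeft⇒γ-< {node l r} (inʳ h) = subst₂ _<_ (sym (γ-nthʳ l r _)) (sym (γ-nthʳ l r _)) (InLeft⇒γ-< h)

-- In `γ (node l r)` the letters of `l` and of the root exceed all letters of `r`, so no ascent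
-- leads from them into `r`. With `InLeft⇒γ-<`, the pairs of `InLeft s` are exactly the
-- noninversions of γ(s), and a single comparison replaces the condition on a whole interval that a
-- general word requires.
γ-<⇒InLeft : ∀ s {a b} → a < b → b < size s → nth (γ s) a < nth (γ s) b → InLeft s a b
γ-<⇒InLeft (node l r) {a} {b} a<b b< lt with <-cmp b (size l)
... | tri< b<l _ _ = inˡ (γ-<⇒InLeft l a<b b<l
        (+-cancelʳ-< (size r) _ _ (subst₂ _<_ (γ-nthˡ l r (<-trans a<b b<l)) (γ-nthˡ l r b<l) lt)))
... | tri≈ _ refl _ = root a<b
... | tri> _ _ l<b with m+[n∸m]≡n l<b
... | eq with +-cancelˡ-< (suc (size l)) (b ∸ suc (size l)) (size r) (subst (_< _) (sym eq) b<)
            | trans (cong (nth (γ (node l r))) (sym eq)) (γ-nthʳ l r _)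
... | b′< | nthb with <-cmp a (size l)
... | tri< a<l _ _ = ⊥-elim (<⇒≱ (subst₂ _<_ (γ-nthˡ l r a<l) nthb lt)
        (≤-trans (proj₂ (γ-bound r b′<)) (m≤n+m _ (nth (γ l) a))))
... | tri≈ _ refl _ = ⊥-elim (<⇒≱ (subst₂ _<_ (γ-nth-root l r) nthb lt)
        (≤-trans (proj₂ (γ-bound r b′<)) (≤-trans (m≤n+m _ (size l)) (m≤m+n _ 1))))
... | tri> _ _ l<a with m+[n∸m]≡n l<a
... | eq′ = subst₂ (InLeft (node l r)) eq′ eq (inʳ (γ-<⇒InLeft r
        (+-cancelˡ-< (suc (size l)) _ _ (subst₂ _<_ (sym eq′) (sym eq) a<b)) b′<
        (subst₂ _<_ (trans (cong (nth (γ (node l r))) (sym eq′)) (γ-nthʳ l r _)) nthb lt)))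

-- Shuffles and the maps f_ζ

insertions-↭ : ∀ {a xs ys} → ys ∈ insertions a xs → ys ↭ a ∷ xs
insertions-↭ {xs = []}     (here refl) = ↭-refl
insertions-↭ {xs = x ∷ xs} (here refl) = ↭-refl
insertions-↭ {xs = x ∷ xs} (there ys∈) with ∈-map⁻ (x ∷_) ys∈
... | zs , zs∈ , refl = ↭-trans (prep x (insertions-↭ zs∈)) (swap x _ ↭-refl)

perms-perm : ∀ n {ζ} → ζ ∈ perms n → IsPermutation n ζ
perms-perm zero (here refl) = ↭-refl
perms-perm (suc n) {ζ} ζ∈ = go (∈-concatMap⁻ (insertions (suc n)) {xs = perms n} ζ∈)
  where
  go : Any.Any (λ σ → ζ ∈ insertions (suc n) σ) (perms n) → IsPermutation (suc n) ζ
  go any with find any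
  ... | σ , σ∈ , ζ∈′ = ↭-trans (insertions-↭ ζ∈′) (↭-trans (prep (suc n) (perms-perm n σ∈))
    (↭-trans (Perm.∷↭∷ʳ (suc n) (range1 n)) (↭-reflexive (sym (range1-suc n)))))

steps⇒StrictlyIncreasing : ∀ {m e} → (∀ {a} → suc a < m → e a < e (suc a)) → StrictlyIncreasing m e
steps⇒StrictlyIncreasing step {a} {suc b} (s≤s a≤b) b<m with m≤n⇒m<n∨m≡n a≤b
... | inj₂ refl = step b<m
... | inj₁ a<b  = <-trans (steps⇒StrictlyIncreasing step a<b (<-trans ≤-refl b<m)) (step b<m)

module Shuffle {p q ζ} (ζ∈ : ζ ∈ Sh p q) where

  private
    ζ∈′ = ∈-filter⁻ (noDescentExcept? p) {xs = perms (p + q)} ζ∈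

  ζ-perm : IsPermutation (p + q) ζ
  ζ-perm = perms-perm (p + q) (proj₁ ζ∈′)

  open Places ζ-perm public

  -- The 0-based indices `a` and `suc a` are the 1-based positions `suc a` and `suc (suc a)`, so a
  -- descent between them is permitted only when `suc a ≡ p`.
  place-step : ∀ {a} → suc a < p + q → suc a ≢ p → place ζ a < place ζ (suc a)
  place-step {a} a< ne
    with All.lookup (proj₂ ζ∈′) (∈-range1⁺ {length ζ ∸ 1} {a} (≤-pred-∸ (subst (suc a <_) (sym (perm-length ζ-perm)) a<)))
    where
    ≤-pred-∸ : ∀ {n} → suc a < n → a < n ∸ 1
    ≤-pred-∸ (s≤s h) = h
  ... | inj₁ eq = contradiction eq ne
  ... | inj₂ lt = ≤-pred (subst₂ _<_ (sym (suc-place (<-trans ≤-refl a<))) (sym (suc-place a<)) lt)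

  placeˡ-mono : StrictlyIncreasing p (place ζ)
  placeˡ-mono = steps⇒StrictlyIncreasing λ a< → place-step (<-≤-trans a< (m≤m+n p q)) (<⇒≢ a<)

  placeʳ-mono : StrictlyIncreasing q (λ a → place ζ (p + a))
  placeʳ-mono = steps⇒StrictlyIncreasing λ {a} a< →
    subst (λ b → place ζ (p + a) < place ζ b) (sym (+-suc p a))
      (place-step (subst (_< p + q) (+-suc p a) (+-monoʳ-< p a<)) (≢-sym (m≢1+m+n p)))

  module _ {s t} (ss : size s ≡ p) (st≡ : size t ≡ q) where

    private
      π = γ s / γ t

      π-perm : IsPermutation (p + q) π
      π-perm = subst₂ (λ p q → IsPermutation (p + q) π) ss st≡ (/-perm (γ-perm s) (γ-perm t))

      σ-perm : IsPermutation (p + q) (π · inv ζ)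
      σ-perm = ·-perm π-perm (inv-perm ζ-perm)

      decreasing : IsDecreasingTree (π · inv ζ) (f ζ s t)
      decreasing = λgo-IsDecreasingTree _ (π · inv ζ) ≤-refl (perm-IsStandard σ-perm)

    f-size : size (f ζ s t) ≡ p + q
    f-size = trans (proj₁ decreasing) (perm-length σ-perm)

    f-≤T⁻ : ∀ {r} → f ζ s t ≤T r → ∀ {a b} → a < p + q → b < p + q →
            InLeft r (place ζ a) (place ζ b) → nth π a < nth π b
    f-≤T⁻ le a< b< h = subst₂ _<_ (nth-·-inv π a<) (nth-·-inv π b<) (proj₁ (proj₂ decreasing) (≤T⇒InLeft le h))

    -- Whenever `i` lies in the left subtree of `j` in `r`, so does every position from `i` to
    -- `j - 1`. The hypothesis then makes all letters at these positions smaller than the one at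
    -- `j`, which is the criterion for the decreasing tree.
    f-≤T⁺ : ∀ {r} → size r ≡ p + q →
            (∀ {a b} → a < p + q → b < p + q → InLeft r (place ζ a) (place ζ b) → nth π a < nth π b) →
            f ζ s t ≤T r
    f-≤T⁺ {r} sr hyp = InLeft⇒≤T (f ζ s t) r (trans f-size (sym sr)) λ h →
      proj₂ (proj₂ decreasing) (InLeft-< h) (subst (_ <_) (trans sr (sym (perm-length σ-perm))) (InLeft-bound h))
        λ i≤m m<j → ascent (InLeft-interval h i≤m m<j)
      where
      ascent : ∀ {i j} → InLeft r i j → nth (π · inv ζ) i < nth (π · inv ζ) j
      ascent h with place-surjective (subst (_ <_) sr (InLeft-boundˡ h)) | place-surjective (subst (_ <_) sr (InLeft-bound h))
      ... | a , a< , refl | b , b< , refl = subst₂ _<_ (sym (nth-·-inv π a<)) (sym (nth-·-inv π b<)) (hyp a< b< h)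

    π-nthˡ : ∀ {a} → a < p → nth π a ≡ nth (γ s) a
    π-nthˡ a<p = nth-++ˡ (γ s) (subst (_ <_) (sym (trans (γ-length s) ss)) a<p)

    π-nthʳ : ∀ {a} → a < q → nth π (p + a) ≡ nth (γ t) a + p
    π-nthʳ {a} a<q = begin
      nth π (p + a)                           ≡⟨ cong (λ n → nth π (n + a)) (trans (γ-length s) ss) ⟨
      nth π (length (γ s) + a)                ≡⟨ nth-++ʳ (γ s) ⟩
      nth (map (_+ length (γ s)) (γ t)) a     ≡⟨ nth-map _ (γ t) (subst (a <_) (sym (trans (γ-length t) st≡)) a<q) ⟩
      nth (γ t) a + length (γ s)              ≡⟨ cong (nth (γ t) a +_) (trans (γ-length s) ss) ⟩
      nth (γ t) a + p                         ∎
      where open ≡-Reasoning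

    π-crossing : ∀ {a b} → a < p → b < q → nth π a < nth π (p + b)
    π-crossing a<p b<q = subst₂ _<_ (sym (π-nthˡ a<p)) (sym (π-nthʳ b<q))
      (≤-trans (s≤s (subst (_ ≤_) ss (proj₂ (γ-bound s (subst (_ <_) (sym ss) a<p)))))
               (+-monoˡ-≤ p (proj₁ (γ-bound t (subst (_ <_) (sym st≡) b<q)))))

  data Side : ℕ → Set where
    inj-s : ∀ {a} → a < p → Side a
    inj-t : ∀ {a} → a < q → Side (p + a)

  side : ∀ {a} → a < p + q → Side a
  side {a} a< with p ≤? a
  ... | no p≰a = inj-s (≰⇒> p≰a)
  ... | yes p≤a = subst Side (m+[n∸m]≡n p≤a) (inj-t (+-cancelˡ-< p _ _ (subst (_< p + q) (sym (m+[n∸m]≡n p≤a)) a<)))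

  -- Letters from different factors compare independently of (s , t), so one
  -- solution of f ζ s t ≤ r shows that the conditions on them always hold.
  principal : ∀ {r} → size r ≡ p + q →
    ∀ {s₁ t₁} → size s₁ ≡ p → size t₁ ≡ q → f ζ s₁ t₁ ≤T r →
    ∃₂ λ s₀ t₀ → size s₀ ≡ p × size t₀ ≡ q ×
      (∀ {s t} → size s ≡ p → size t ≡ q →
        (f ζ s t ≤T r → s ≤T s₀ × t ≤T t₀) × (s ≤T s₀ → t ≤T t₀ → f ζ s t ≤T r))
  principal {r} sr {s₁} {t₁} ss₁ st₁ le₁
    with restrict r p (place ζ) placeˡ-mono (λ a< → subst (_ <_) (sym sr) (place-< (<-≤-trans a< (m≤m+n p q))))
       | restrict r q (λ a → place ζ (p + a)) placeʳ-mono (λ a< → subst (_ <_) (sym sr) (place-< (+-monoʳ-< p a<)))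
  ... | s₀ , ss₀ , forthˢ , backˢ | t₀ , st₀ , forthᵗ , backᵗ = s₀ , t₀ , ss₀ , st₀ , λ ss st → only-if ss st , if ss st
    where
    ˡ< : ∀ {a} → a < p → a < p + q
    ˡ< a< = <-≤-trans a< (m≤m+n p q)

    only-if : ∀ {s t} → size s ≡ p → size t ≡ q → f ζ s t ≤T r → s ≤T s₀ × t ≤T t₀
    only-if {s} {t} ss st le = InLeft⇒≤T s s₀ (trans ss (sym ss₀)) subˢ , InLeft⇒≤T t t₀ (trans st (sym st₀)) subᵗ
      where
      subˢ : ∀ {a b} → InLeft s₀ a b → InLeft s a b
      subˢ h = γ-<⇒InLeft s (InLeft-< h) (subst (_ <_) (sym ss) b<)
        (subst₂ _<_ (π-nthˡ ss st a<) (π-nthˡ ss st b<) (f-≤T⁻ ss st le (ˡ< a<) (ˡ< b<) (forthˢ h)))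
        where
        a< = subst (_ <_) ss₀ (InLeft-boundˡ h)
        b< = subst (_ <_) ss₀ (InLeft-bound h)
      subᵗ : ∀ {a b} → InLeft t₀ a b → InLeft t a b
      subᵗ h = γ-<⇒InLeft t (InLeft-< h) (subst (_ <_) (sym st) b<)
        (+-cancelʳ-< p _ _ (subst₂ _<_ (π-nthʳ ss st a<) (π-nthʳ ss st b<)
          (f-≤T⁻ ss st le (+-monoʳ-< p a<) (+-monoʳ-< p b<) (forthᵗ h))))
        where
        a< = subst (_ <_) st₀ (InLeft-boundˡ h)
        b< = subst (_ <_) st₀ (InLeft-bound h)

    if : ∀ {s t} → size s ≡ p → size t ≡ q → s ≤T s₀ → t ≤T t₀ → f ζ s t ≤T r
    if {s} {t} ss st s≤ t≤ = f-≤T⁺ ss st sr λ a< b< → ascent (side a<) (side b<)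
      where
      ascent : ∀ {a b} → Side a → Side b → InLeft r (place ζ a) (place ζ b) → nth (γ s / γ t) a < nth (γ s / γ t) b
      ascent (inj-s a<) (inj-s b<) h = subst₂ _<_ (sym (π-nthˡ ss st a<)) (sym (π-nthˡ ss st b<))
        (InLeft⇒γ-< (≤T⇒InLeft s≤ (backˢ a< b< h)))
      ascent (inj-t a<) (inj-t b<) h = subst₂ _<_ (sym (π-nthʳ ss st a<)) (sym (π-nthʳ ss st b<))
        (+-monoˡ-< p (InLeft⇒γ-< (≤T⇒InLeft t≤ (backᵗ a< b< h))))
      ascent (inj-s a<) (inj-t b<) h = π-crossing ss st a< b<
      -- Such a pair of `r` would make `le₁` demand that a letter of the second factor be smaller
      -- than one of the first, so `r` has none.
      ascent (inj-t a<) (inj-s b<) h =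
        ⊥-elim (<-asym (π-crossing ss₁ st₁ b< a<) (f-≤T⁻ ss₁ st₁ le₁ (+-monoʳ-< p a<) (ˡ< b<) h))

-- Möbius inversion

open import Data.Integer using (+_)

-- Brings `upToDepth` into a form to which the library results on uniqueness and membership apply.
concatMap-map : ∀ {A B C : Set} (g : A → B → C) xs ys →
                concatMap (λ x → map (g x) ys) xs ≡ cartesianProductWith g xs ys
concatMap-map g []       ys = refl
concatMap-map g (x ∷ xs) ys = cong (map (g x) ys ++_) (concatMap-map g xs ys)

upToDepth-unique : ∀ d → Unique (upToDepth d)
upToDepth-unique zero    = [] ∷ []
upToDepth-unique (suc d) rewrite concatMap-map node (upToDepth d) (upToDepth d) =
  All.tabulate leaf∉ ∷
  Unique.cartesianProductWith⁺ node (λ { refl → refl , refl }) (upToDepth-unique d) (upToDepth-unique d)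
  where
  leaf∉ : ∀ {t} → t ∈ cartesianProductWith node (upToDepth d) (upToDepth d) → leaf ≢ t
  leaf∉ t∈ refl with ∈-cartesianProductWith⁻ node (upToDepth d) (upToDepth d) t∈
  ... | _ , _ , _ , _ , ()

∈-upToDepth : ∀ t {d} → size t ≤ d → t ∈ upToDepth d
∈-upToDepth leaf {zero}  _ = here refl
∈-upToDepth leaf {suc d} _ = here refl
∈-upToDepth (node l r) {suc d} (s≤s h) rewrite concatMap-map node (upToDepth d) (upToDepth d) =
  there (∈-cartesianProductWith⁺ node (∈-upToDepth l (≤-trans (m≤m+n _ _) h))
                                      (∈-upToDepth r (≤-trans (m≤n+m _ (size l)) h)))

∈-trees⁺ : ∀ {t n} → size t ≡ n → t ∈ trees n
∈-trees⁺ {t} {n} eq = ∈-filter⁺ (λ t → size t ≟ n) (∈-upToDepth t (≤-reflexive eq)) eq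

∈-trees⁻ : ∀ {t n} → t ∈ trees n → size t ≡ n
∈-trees⁻ {t} {n} t∈ = proj₂ (∈-filter⁻ (λ t → size t ≟ n) {xs = upToDepth n} t∈)

trees-unique : ∀ n → Unique (trees n)
trees-unique n = Unique.filter⁺ (λ t → size t ≟ n) (upToDepth-unique n)

-- Finite sums and indicators

sumZ-cong : ∀ {A : Set} {g h : A → ℤ} xs → (∀ {x} → x ∈ xs → g x ≡ h x) → sumZ xs g ≡ sumZ xs h
sumZ-cong []       eq = refl
sumZ-cong (x ∷ xs) eq = cong₂ _⊕_ (eq (here refl)) (sumZ-cong xs (eq ∘ there))

sumZ-0 : ∀ {A : Set} {g : A → ℤ} xs → (∀ {x} → x ∈ xs → g x ≡ 0ℤ) → sumZ xs g ≡ 0ℤ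
sumZ-0 []       eq = refl
sumZ-0 (x ∷ xs) eq = cong₂ _⊕_ (eq (here refl)) (sumZ-0 xs (eq ∘ there))

sumZ-+ : ∀ {A : Set} (g h : A → ℤ) xs → sumZ xs (λ x → g x ⊕ h x) ≡ sumZ xs g ⊕ sumZ xs h
sumZ-+ g h []       = refl
sumZ-+ g h (x ∷ xs) = trans (cong ((g x ⊕ h x) ⊕_) (sumZ-+ g h xs)) (interchange (g x) (h x) _ _)
  where
  interchange : ∀ a b c d → a ⊕ b ⊕ (c ⊕ d) ≡ a ⊕ c ⊕ (b ⊕ d)
  interchange = solve-∀

sumZ-*ˡ : ∀ {A : Set} c (g : A → ℤ) xs → c * sumZ xs g ≡ sumZ xs (λ x → c * g x)
sumZ-*ˡ c g []       = ℤ.*-zeroʳ c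
sumZ-*ˡ c g (x ∷ xs) = trans (ℤ.*-distribˡ-+ c (g x) _) (cong (c * g x ⊕_) (sumZ-*ˡ c g xs))

sumZ-*ʳ : ∀ {A : Set} (g : A → ℤ) c xs → sumZ xs g * c ≡ sumZ xs (λ x → g x * c)
sumZ-*ʳ g c []       = refl
sumZ-*ʳ g c (x ∷ xs) = trans (ℤ.*-distribʳ-+ c (g x) _) (cong (g x * c ⊕_) (sumZ-*ʳ g c xs))

sumZ-swap : ∀ {A B : Set} (g : A → B → ℤ) xs ys →
            sumZ xs (λ x → sumZ ys (g x)) ≡ sumZ ys (λ y → sumZ xs (λ x → g x y))
sumZ-swap g []       ys = sym (sumZ-0 ys (λ _ → refl))
sumZ-swap g (x ∷ xs) ys = trans (cong (sumZ ys (g x) ⊕_) (sumZ-swap g xs ys)) (sym (sumZ-+ (g x) _ ys))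

𝟙 : {P : Set} → Dec P → ℤ
𝟙 (yes _) = 1ℤ
𝟙 (no _)  = 0ℤ

𝟙-yes : {P : Set} (P? : Dec P) → P → 𝟙 P? ≡ 1ℤ
𝟙-yes (yes _) _ = refl
𝟙-yes (no ¬p) p = contradiction p ¬p

𝟙-no : {P : Set} (P? : Dec P) → ¬ P → 𝟙 P? ≡ 0ℤ
𝟙-no (yes p) ¬p = contradiction p ¬p
𝟙-no (no _)  _  = refl

𝟙-×-cong : {P Q R : Set} (P? : Dec P) (Q? : Dec Q) (R? : Dec R) →
           (R → P × Q) → (P → Q → R) → 𝟙 R? ≡ 𝟙 P? * 𝟙 Q?
𝟙-×-cong (yes p) (yes q) R? _ g  = 𝟙-yes R? (g p q)
𝟙-×-cong (yes p) (no ¬q) R? h _  = 𝟙-no R? (¬q ∘ proj₂ ∘ h)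
𝟙-×-cong (no ¬p) Q?      R? h _  = 𝟙-no R? (¬p ∘ proj₁ ∘ h)

sumZ-filter : ∀ {A : Set} {P : A → Set} (P? : ∀ x → Dec (P x)) (g : A → ℤ) xs →
              sumZ (filter P? xs) g ≡ sumZ xs (λ x → 𝟙 (P? x) * g x)
sumZ-filter P? g [] = refl
sumZ-filter P? g (x ∷ xs) with P? x
... | yes _ = cong₂ _⊕_ (sym (ℤ.*-identityˡ (g x))) (sumZ-filter P? g xs)
... | no _  = trans (sumZ-filter P? g xs) (sym (ℤ.+-identityˡ _))

count-sumZ : ∀ {A : Set} {P : A → Set} (P? : ∀ x → Dec (P x)) xs → + count P? xs ≡ sumZ xs (𝟙 ∘ P?)
count-sumZ P? [] = refl
count-sumZ P? (x ∷ xs) with P? x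
... | yes _ = trans (ℤ.pos-+ 1 _) (cong (1ℤ ⊕_) (count-sumZ P? xs))
... | no _  = trans (count-sumZ P? xs) (sym (ℤ.+-identityˡ _))

sumZ-δ : ∀ {x} (g : BT → ℤ) {xs} → Unique xs → x ∈ xs → sumZ xs (λ y → 𝟙 (x ≟BT y) * g y) ≡ g x
sumZ-δ {x} g {_ ∷ xs} (x∉ ∷ _) (here refl) = trans
  (cong₂ _⊕_ (trans (cong (_* g x) (𝟙-yes (x ≟BT x) refl)) (ℤ.*-identityˡ (g x)))
               (sumZ-0 xs λ {y} y∈ → cong (_* g y) (𝟙-no (x ≟BT y) (All.lookup x∉ y∈))))
  (ℤ.+-identityʳ (g x))
sumZ-δ {x} g {y ∷ _} (y∉ ∷ u) (there x∈) = trans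
  (cong₂ _⊕_ (cong (_* g y) (𝟙-no (x ≟BT y) (≢-sym (All.lookup y∉ x∈)))) (sumZ-δ g u x∈))
  (ℤ.+-identityˡ (g x))

-- The Möbius function and sums over principal ideals

module Möbius (_≤?_ : Decidable _≤T_) where
  open WithDec _≤?_

  -- The size of the principal ideal of `s`. It strictly increases along the order, so it bounds the
  -- depth of the recursion for `μ` and serves as an induction measure.
  rank : BT → ℕ
  rank s = count (_≤? s) (trees (size s))

  rank-pos : ∀ s → 0 < rank s
  rank-pos s = ∈-length (∈-filter⁺ (_≤? s) (∈-trees⁺ {s} refl) ε)

  rank-≤ : ∀ s {n} → size s ≡ n → rank s ≤ length (trees n)
  rank-≤ s refl = List.length-filter (_≤? s) (trees (size s))

  rank-strict : ∀ {u s} → u ≤T s → u ≢ s → rank u < rank s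
  rank-strict {u} {s} u≤s u≢s = subst (λ n → count (_≤? u) (trees n) < rank s) (sym (≤T-size u≤s))
    (count-strict (_≤? u) (_≤? s) (_◅◅ u≤s) (∈-trees⁺ {s} refl) (u≢s ∘ ≤T-antisym u≤s) ε)

  strictly-below? : ∀ s u → Dec (u ≤T s × ¬ u ≡ s)
  strictly-below? s u = (u ≤? s) ×-dec ¬? (u ≟BT s)

  between : BT → BT → List BT
  between t s = filter (λ u → (t ≤? u) ×-dec strictly-below? s u) (trees (size t))

  μgo-refl : ∀ k t → μgo (suc k) t t ≡ 1ℤ
  μgo-refl k t with t ≟BT t
  ... | yes _ = refl
  ... | no ne = contradiction refl ne

  μgo-≰ : ∀ k {t s} → ¬ t ≤T s → μgo (suc k) t s ≡ 0ℤ
  μgo-≰ k {t} {s} t≰s with t ≟BT s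
  ... | yes refl = contradiction ε t≰s
  ... | no _ with t ≤? s
  ... | yes t≤s = contradiction t≤s t≰s
  ... | no _    = refl

  μgo-< : ∀ k {t s} → t ≢ s → t ≤T s → μgo (suc k) t s ≡ ⊖ sumZ (between t s) (μgo k t)
  μgo-< k {t} {s} t≢s t≤s with t ≟BT s
  ... | yes t≡s = contradiction t≡s t≢s
  ... | no _ with t ≤? s
  ... | yes _   = refl
  ... | no t≰s  = contradiction t≤s t≰s

  ∈-between⁻ : ∀ {t s u} → u ∈ between t s → t ≤T u × u ≤T s × u ≢ s
  ∈-between⁻ {t} {s} u∈ = proj₂ (∈-filter⁻ (λ u → (t ≤? u) ×-dec strictly-below? s u) {xs = trees (size t)} u∈)

  -- Each recursive call passes to a tree of smaller `rank`, so fuel `rank s` is already enough and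
  -- more does not change the value.
  μgo-fuel : ∀ k k′ t s → rank s ≤ k → rank s ≤ k′ → μgo k t s ≡ μgo k′ t s
  μgo-fuel zero    _    t s h _  = contradiction h (<⇒≱ (rank-pos s))
  μgo-fuel (suc _) zero t s _ h′ = contradiction h′ (<⇒≱ (rank-pos s))
  μgo-fuel (suc k) (suc k′) t s h h′ = cases (t ≟BT s) (t ≤? s)
    where
    cases : Dec (t ≡ s) → Dec (t ≤T s) → μgo (suc k) t s ≡ μgo (suc k′) t s
    cases (yes refl) _ = trans (μgo-refl k t) (sym (μgo-refl k′ t))
    cases (no _) (no t≰s) = trans (μgo-≰ k t≰s) (sym (μgo-≰ k′ t≰s))
    cases (no t≢s) (yes t≤s) = trans (μgo-< k t≢s t≤s) (trans (cong ⊖_ (sumZ-cong (between t s) below)) (sym (μgo-< k′ t≢s t≤s)))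
      where
      below : ∀ {u} → u ∈ between t s → μgo k t u ≡ μgo k′ t u
      below {u} u∈ with ∈-between⁻ {t} {s} u∈
      ... | _ , u≤s , u≢s = μgo-fuel k k′ t u (≤-pred (≤-trans (rank-strict u≤s u≢s) h))
                                              (≤-pred (≤-trans (rank-strict u≤s u≢s) h′))

  μ-refl : ∀ t → μ t t ≡ 1ℤ
  μ-refl t = go (length (trees (size t))) (rank-≤ t refl)
    where
    go : ∀ N → rank t ≤ N → μgo N t t ≡ 1ℤ
    go zero h    = contradiction h (<⇒≱ (rank-pos t))
    go (suc k) _ = μgo-refl k t

  -- Unfolding `μ` costs one unit of fuel. `μgo-fuel` restores it, because the trees of the interval
  -- have smaller rank than `s`.
  μ-< : ∀ {t s} → t ≢ s → t ≤T s → μ t s ≡ ⊖ sumZ (between t s) (μ t)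
  μ-< {t} {s} t≢s t≤s = go (length (trees (size t))) (rank-≤ s (sym (≤T-size t≤s)))
    where
    go : ∀ N → rank s ≤ N → μgo N t s ≡ ⊖ sumZ (between t s) (μgo N t)
    go zero h    = contradiction h (<⇒≱ (rank-pos s))
    go (suc k) h = trans (μgo-< k t≢s t≤s) (cong ⊖_ (sumZ-cong (between t s) below))
      where
      below : ∀ {u} → u ∈ between t s → μgo k t u ≡ μgo (suc k) t u
      below {u} u∈ with ∈-between⁻ {t} {s} u∈
      ... | _ , u≤s , u≢s = μgo-fuel k (suc k) t u u≤k (m≤n⇒m≤1+n u≤k)
        where
        u≤k : rank u ≤ k
        u≤k = ≤-pred (≤-trans (rank-strict u≤s u≢s) h)

  M-≤ : ∀ {t u} → t ≤T u → M t u ≡ μ t u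
  M-≤ {t} {u} t≤u with t ≤? u
  ... | yes _  = refl
  ... | no t≰u = contradiction t≤u t≰u

  M-≰ : ∀ {t u} → ¬ t ≤T u → M t u ≡ 0ℤ
  M-≰ {t} {u} t≰u with t ≤? u
  ... | yes t≤u = contradiction t≤u t≰u
  ... | no _    = refl

  -- `M t u` vanishes unless `t ≤T u`, so the lower end of the interval need not appear in the
  -- indicator on the right.
  M-between : ∀ t s u → 𝟙 ((t ≤? u) ×-dec strictly-below? s u) * μ t u ≡ 𝟙 (strictly-below? s u) * M t u
  M-between t s u with t ≤? u
  ... | no _  = sym (ℤ.*-zeroʳ (𝟙 (strictly-below? s u)))
  ... | yes _ with strictly-below? s u
  ... | yes _ = refl
  ... | no _  = refl

  -- The zeta transform of `X`, inverse to the Möbius transform: it turns `M t` into the indicator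
  -- of `t`.
  downSum : ℕ → (BT → ℤ) → BT → ℤ
  downSum n X r = sumZ (trees n) (λ u → 𝟙 (u ≤? r) * X u)

  strictDownSum : ℕ → (BT → ℤ) → BT → ℤ
  strictDownSum n X r = sumZ (trees n) (λ u → 𝟙 (strictly-below? r u) * X u)

  downSum-split : ∀ {n r} X → size r ≡ n → downSum n X r ≡ strictDownSum n X r ⊕ X r
  downSum-split {n} {r} X sr = begin
    downSum n X r
      ≡⟨ sumZ-cong (trees n) (λ {u} _ → split u) ⟩
    sumZ (trees n) (λ u → 𝟙 (strictly-below? r u) * X u ⊕ 𝟙 (r ≟BT u) * X u)
      ≡⟨ sumZ-+ _ _ (trees n) ⟩
    strictDownSum n X r ⊕ sumZ (trees n) (λ u → 𝟙 (r ≟BT u) * X u)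
      ≡⟨ cong (strictDownSum n X r ⊕_) (sumZ-δ X (trees-unique n) (∈-trees⁺ sr)) ⟩
    strictDownSum n X r ⊕ X r ∎
    where
    open ≡-Reasoning
    indicator : ∀ u → 𝟙 (u ≤? r) ≡ 𝟙 (strictly-below? r u) ⊕ 𝟙 (r ≟BT u)
    indicator u = cases (r ≟BT u)
      where
      cases : Dec (r ≡ u) → _
      cases (yes refl) = trans (𝟙-yes (r ≤? r) ε)
        (sym (cong₂ _⊕_ (𝟙-no (strictly-below? r r) (λ (_ , ne) → ne refl)) (𝟙-yes (r ≟BT r) refl)))
      cases (no ne) = trans (lhs (u ≤? r)) (sym (trans (cong (𝟙 (strictly-below? r u) ⊕_) (𝟙-no (r ≟BT u) ne)) (ℤ.+-identityʳ _)))
        where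
        lhs : (d : Dec (u ≤T r)) → 𝟙 d ≡ 𝟙 (strictly-below? r u)
        lhs (yes u≤r) = sym (𝟙-yes (strictly-below? r u) (u≤r , ne ∘ sym))
        lhs (no u≰r)  = sym (𝟙-no (strictly-below? r u) (u≰r ∘ proj₁))
    split : ∀ u → 𝟙 (u ≤? r) * X u ≡ 𝟙 (strictly-below? r u) * X u ⊕ 𝟙 (r ≟BT u) * X u
    split u = trans (cong (_* X u) (indicator u)) (ℤ.*-distribʳ-+ (X u) (𝟙 (strictly-below? r u)) _)

  -- Induction on the rank of `r`: the terms strictly below `r` agree already, and cancelling them
  -- leaves the values at `r`.
  downSum-injective : ∀ {n X Y} → (∀ {r} → size r ≡ n → downSum n X r ≡ downSum n Y r) →
                      ∀ {r} → size r ≡ n → X r ≡ Y r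
  downSum-injective {n} {X} {Y} eq {r} = go (rank r) ≤-refl
    where
    go : ∀ k {r} → rank r ≤ k → size r ≡ n → X r ≡ Y r
    go zero {r} h _ = contradiction h (<⇒≱ (rank-pos r))
    go (suc k) {r} h sr = ∙-cancelˡ ℤ.+-0-abelianGroup (strictDownSum n Y r) _ _ (begin
      strictDownSum n Y r ⊕ X r ≡⟨ cong (_⊕ X r) (sumZ-cong (trees n) (λ {u} _ → below u)) ⟨
      strictDownSum n X r ⊕ X r ≡⟨ downSum-split X sr ⟨
      downSum n X r               ≡⟨ eq sr ⟩
      downSum n Y r               ≡⟨ downSum-split Y sr ⟩
      strictDownSum n Y r ⊕ Y r ∎)
      where
      open ≡-Reasoning
      below : ∀ u → 𝟙 (strictly-below? r u) * X u ≡ 𝟙 (strictly-below? r u) * Y u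
      below u with strictly-below? r u
      ... | no _ = refl
      ... | yes (u≤r , u≢r) = cong (1ℤ *_)
        (go k (≤-pred (≤-trans (rank-strict u≤r u≢r) h)) (trans (≤T-size u≤r) sr))

  -- For `t` strictly below `s`, the recursion for `μ` makes the term at `s` cancel all others. For
  -- `t ≡ s` only μ(t,t) = 1 survives, and for `t` not below `s` every term is zero.
  downSum-M : ∀ {n t s} → size t ≡ n → size s ≡ n → downSum n (M t) s ≡ 𝟙 (t ≟BT s)
  downSum-M {n} {t} {s} refl ss = cases (t ≟BT s) (t ≤? s)
    where
    open ≡-Reasoning
    vanish : ∀ {P : BT → Set} (P? : ∀ u → Dec (P u)) → (∀ {u} → P u → ¬ t ≤T u) →
             sumZ (trees n) (λ u → 𝟙 (P? u) * M t u) ≡ 0ℤ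
    vanish P? h = sumZ-0 (trees n) λ {u} _ → term u
      where
      term : ∀ u → 𝟙 (P? u) * M t u ≡ 0ℤ
      term u with P? u
      ... | yes p = trans (ℤ.*-identityˡ (M t u)) (M-≰ (h p))
      ... | no _  = refl
    cases : (d : Dec (t ≡ s)) → Dec (t ≤T s) → downSum n (M t) s ≡ 𝟙 d
    cases (yes refl) _ = begin
      downSum n (M t) t                   ≡⟨ downSum-split {r = t} (M t) refl ⟩
      strictDownSum n (M t) t ⊕ M t t   ≡⟨ cong₂ _⊕_ (vanish (strictly-below? t) (λ (u≤t , u≢t) t≤u → u≢t (≤T-antisym u≤t t≤u)))
                                                        (trans (M-≤ ε) (μ-refl t)) ⟩
      1ℤ                                  ∎
    cases (no t≢s) (no t≰s) = vanish (_≤? s) (λ u≤s t≤u → t≰s (t≤u ◅◅ u≤s))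
    cases (no t≢s) (yes t≤s) = begin
      downSum n (M t) s                   ≡⟨ downSum-split (M t) ss ⟩
      strictDownSum n (M t) s ⊕ M t s   ≡⟨ cong (strictDownSum n (M t) s ⊕_) (trans (M-≤ t≤s) (μ-< t≢s t≤s)) ⟩
      strictDownSum n (M t) s ⊕ ⊖ sumZ (between t s) (μ t)
        ≡⟨ cong (λ z → strictDownSum n (M t) s ⊕ ⊖ z)
             (trans (sumZ-filter _ (μ t) (trees n)) (sumZ-cong (trees n) (λ {u} _ → M-between t s u))) ⟩
      strictDownSum n (M t) s ⊕ ⊖ strictDownSum n (M t) s ≡⟨ ℤ.+-inverseʳ (strictDownSum n (M t) s) ⟩
      0ℤ                                  ∎

  -- By linearity and `downSum-M`, summing over the ideal of `r` reads off the coefficient of `M r`.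
  downSum-combination : ∀ {n r} (c : BT → ℤ) → size r ≡ n →
    downSum n (λ u → sumZ (trees n) (λ r′ → c r′ * M r′ u)) r ≡ c r
  downSum-combination {n} {r} c sr = begin
    sumZ (trees n) (λ u → 𝟙 (u ≤? r) * sumZ (trees n) (λ r′ → c r′ * M r′ u))
      ≡⟨ sumZ-cong (trees n) (λ {u} _ → trans (sumZ-*ˡ (𝟙 (u ≤? r)) _ (trees n))
           (sumZ-cong (trees n) (λ {r′} _ → move (𝟙 (u ≤? r)) (c r′) (M r′ u)))) ⟩
    sumZ (trees n) (λ u → sumZ (trees n) (λ r′ → c r′ * (𝟙 (u ≤? r) * M r′ u)))
      ≡⟨ sumZ-swap _ (trees n) (trees n) ⟩
    sumZ (trees n) (λ r′ → sumZ (trees n) (λ u → c r′ * (𝟙 (u ≤? r) * M r′ u)))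
      ≡⟨ sumZ-cong (trees n) (λ {r′} r′∈ → trans (sym (sumZ-*ˡ (c r′) _ (trees n))) (delta r′ (∈-trees⁻ r′∈))) ⟩
    sumZ (trees n) (λ r′ → 𝟙 (r ≟BT r′) * c r′)
      ≡⟨ sumZ-δ c (trees-unique n) (∈-trees⁺ sr) ⟩
    c r ∎
    where
    open ≡-Reasoning
    move : ∀ a b c → a * (b * c) ≡ b * (a * c)
    move = solve-∀
    sym-𝟙 : ∀ r′ → 𝟙 (r′ ≟BT r) ≡ 𝟙 (r ≟BT r′)
    sym-𝟙 r′ with r ≟BT r′
    ... | yes eq = 𝟙-yes (r′ ≟BT r) (sym eq)
    ... | no ne  = 𝟙-no (r′ ≟BT r) (ne ∘ sym)
    delta : ∀ r′ → size r′ ≡ n → c r′ * downSum n (M r′) r ≡ 𝟙 (r ≟BT r′) * c r′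
    delta r′ sr′ = trans (cong (c r′ *_) (trans (downSum-M sr′ sr) (sym-𝟙 r′))) (ℤ.*-comm (c r′) _)

  -- The product of two monomial basis elements

  module Product {p q s t} (ss : size s ≡ p) (st≡ : size t ≡ q) where

    -- If no pair satisfies `f ζ s′ t′ ≤T r`, both sides are zero. Otherwise `principal` factors the
    -- indicator, the double sum becomes a product of two sums over principal ideals, and
    -- `downSum-M` evaluates it to 1 exactly when `(s , t)` is the maximum `(s₀ , t₀)`.
    maxIs-sum : ∀ {ζ r} → ζ ∈ Sh p q → size r ≡ p + q →
      sumZ (trees p) (λ s′ → sumZ (trees q) (λ t′ → M s s′ * M t t′ * 𝟙 (f ζ s′ t′ ≤? r)))
        ≡ 𝟙 (maxIs? p q r s t ζ)
    maxIs-sum {ζ} {r} ζ∈ sr = cases (any? (λ s′ → any? (λ t′ → f ζ s′ t′ ≤? r) (trees q)) (trees p))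
      where
      open ≡-Reasoning
      open Shuffle {p} {q} ζ∈
      cases : Dec (Any.Any (λ s′ → Any.Any (λ t′ → f ζ s′ t′ ≤T r) (trees q)) (trees p)) →
        sumZ (trees p) (λ s′ → sumZ (trees q) (λ t′ → M s s′ * M t t′ * 𝟙 (f ζ s′ t′ ≤? r)))
          ≡ 𝟙 (maxIs? p q r s t ζ)
      cases (no none) = trans
        (sumZ-0 (trees p) λ {s′} s′∈ → sumZ-0 (trees q) λ {t′} t′∈ →
          trans (cong (M s s′ * M t t′ *_) (𝟙-no (f ζ s′ t′ ≤? r) (λ le → none (lose s′∈ (lose t′∈ le)))))
                (ℤ.*-zeroʳ (M s s′ * M t t′)))
        (sym (𝟙-no (maxIs? p q r s t ζ) (λ (le , _) → none (lose (∈-trees⁺ ss) (lose (∈-trees⁺ st≡) le)))))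
      cases (yes some) with find some
      ... | s₁ , s₁∈ , some′ with find some′
      ... | t₁ , t₁∈ , le₁ with principal sr (∈-trees⁻ s₁∈) (∈-trees⁻ t₁∈) le₁
      ... | s₀ , t₀ , ss₀ , st₀ , iff = begin
        sumZ (trees p) (λ s′ → sumZ (trees q) (λ t′ → M s s′ * M t t′ * 𝟙 (f ζ s′ t′ ≤? r)))
          ≡⟨ sumZ-cong (trees p) (λ {s′} s′∈ → sumZ-cong (trees q) (λ {t′} t′∈ → term s′∈ t′∈)) ⟩
        sumZ (trees p) (λ s′ → sumZ (trees q) (λ t′ → (𝟙 (s′ ≤? s₀) * M s s′) * (𝟙 (t′ ≤? t₀) * M t t′)))
          ≡⟨ sumZ-cong (trees p) (λ {s′} _ → sym (sumZ-*ˡ (𝟙 (s′ ≤? s₀) * M s s′) _ (trees q))) ⟩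
        sumZ (trees p) (λ s′ → (𝟙 (s′ ≤? s₀) * M s s′) * downSum q (M t) t₀)
          ≡⟨ sumZ-*ʳ _ (downSum q (M t) t₀) (trees p) ⟨
        downSum p (M s) s₀ * downSum q (M t) t₀
          ≡⟨ cong₂ _*_ (downSum-M ss ss₀) (downSum-M st≡ st₀) ⟩
        𝟙 (s ≟BT s₀) * 𝟙 (t ≟BT t₀)
          ≡⟨ 𝟙-×-cong (s ≟BT s₀) (t ≟BT t₀) (maxIs? p q r s t ζ) max⇒ ⇒max ⟨
        𝟙 (maxIs? p q r s t ζ) ∎
        where
        rearrange : ∀ a b x y → a * b * (x * y) ≡ (x * a) * (y * b)
        rearrange = solve-∀
        term : ∀ {s′ t′} → s′ ∈ trees p → t′ ∈ trees q →
          M s s′ * M t t′ * 𝟙 (f ζ s′ t′ ≤? r) ≡ (𝟙 (s′ ≤? s₀) * M s s′) * (𝟙 (t′ ≤? t₀) * M t t′)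
        term {s′} {t′} s′∈ t′∈ = trans
          (cong (M s s′ * M t t′ *_) (𝟙-×-cong (s′ ≤? s₀) (t′ ≤? t₀) (f ζ s′ t′ ≤? r)
            (proj₁ (iff (∈-trees⁻ s′∈) (∈-trees⁻ t′∈))) (proj₂ (iff (∈-trees⁻ s′∈) (∈-trees⁻ t′∈)))))
          (rearrange (M s s′) (M t t′) (𝟙 (s′ ≤? s₀)) (𝟙 (t′ ≤? t₀)))
        max⇒ : MaxIs p q ζ r s t → s ≡ s₀ × t ≡ t₀
        max⇒ (le , max) with proj₁ (iff ss st≡) le
          | All.lookup (All.lookup max (∈-trees⁺ ss₀)) (∈-trees⁺ st₀) (proj₂ (iff ss₀ st₀) ε ε)
        ... | s≤s₀ , t≤t₀ | s₀≤s , t₀≤t = ≤T-antisym s≤s₀ s₀≤s , ≤T-antisym t≤t₀ t₀≤t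
        ⇒max : s ≡ s₀ → t ≡ t₀ → MaxIs p q ζ r s t
        ⇒max refl refl = proj₂ (iff ss st≡) ε ε ,
          All.tabulate λ s′∈ → All.tabulate λ t′∈ → proj₁ (iff (∈-trees⁻ s′∈) (∈-trees⁻ t′∈))

    -- Each shuffle contributes a single fundamental basis element, and it is counted iff its tree
    -- lies below `r`.
    downSum-FF : ∀ {s′ t′ r} → size s′ ≡ p → size t′ ≡ q →
      downSum (p + q) (FF p q s′ t′) r ≡ sumZ (Sh p q) (λ ζ → 𝟙 (f ζ s′ t′ ≤? r))
    downSum-FF {s′} {t′} {r} ss′ st′ = begin
      sumZ T (λ u → 𝟙 (u ≤? r) * + count (λ ζ → f ζ s′ t′ ≟BT u) (Sh p q))
        ≡⟨ sumZ-cong T (λ {u} _ → trans (cong (𝟙 (u ≤? r) *_) (count-sumZ _ (Sh p q)))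
             (trans (sumZ-*ˡ (𝟙 (u ≤? r)) _ (Sh p q)) (sumZ-cong (Sh p q) (λ {ζ} _ → ℤ.*-comm (𝟙 (u ≤? r)) _)))) ⟩
      sumZ T (λ u → sumZ (Sh p q) (λ ζ → 𝟙 (f ζ s′ t′ ≟BT u) * 𝟙 (u ≤? r)))
        ≡⟨ sumZ-swap _ T (Sh p q) ⟩
      sumZ (Sh p q) (λ ζ → sumZ T (λ u → 𝟙 (f ζ s′ t′ ≟BT u) * 𝟙 (u ≤? r)))
        ≡⟨ sumZ-cong (Sh p q) (λ {ζ} ζ∈ → sumZ-δ (λ u → 𝟙 (u ≤? r)) (trees-unique (p + q))
             (∈-trees⁺ (Shuffle.f-size {p} {q} ζ∈ ss′ st′))) ⟩
      sumZ (Sh p q) (λ ζ → 𝟙 (f ζ s′ t′ ≤? r)) ∎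
      where
      open ≡-Reasoning
      T = trees (p + q)

    -- Exchanging the sums puts the one over shuffles outermost, and `maxIs-sum` evaluates the inner
    -- sums for each `ζ` separately.
    downSum-prod : ∀ {r} → size r ≡ p + q → downSum (p + q) (prod p q (M s) (M t)) r ≡ + coeff p q s t r
    downSum-prod {r} sr = begin
      sumZ T (λ u → 𝟙 (u ≤? r) * sumZ P (λ s′ → sumZ Q (λ t′ → c s′ t′ * FF p q s′ t′ u)))
        ≡⟨ sumZ-cong T (λ {u} _ → trans (sumZ-*ˡ (𝟙 (u ≤? r)) _ P) (sumZ-cong P (λ {s′} _ →
             trans (sumZ-*ˡ (𝟙 (u ≤? r)) _ Q) (sumZ-cong Q (λ {t′} _ → move (𝟙 (u ≤? r)) (c s′ t′) (FF p q s′ t′ u)))))) ⟩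
      sumZ T (λ u → sumZ P (λ s′ → sumZ Q (λ t′ → c s′ t′ * (𝟙 (u ≤? r) * FF p q s′ t′ u))))
        ≡⟨ trans (sumZ-swap _ T P) (sumZ-cong P (λ _ → sumZ-swap _ T Q)) ⟩
      sumZ P (λ s′ → sumZ Q (λ t′ → sumZ T (λ u → c s′ t′ * (𝟙 (u ≤? r) * FF p q s′ t′ u))))
        ≡⟨ sumZ-cong P (λ {s′} s′∈ → sumZ-cong Q (λ {t′} t′∈ → trans (sym (sumZ-*ˡ (c s′ t′) _ T))
             (trans (cong (c s′ t′ *_) (downSum-FF (∈-trees⁻ s′∈) (∈-trees⁻ t′∈))) (sumZ-*ˡ (c s′ t′) _ Z)))) ⟩
      sumZ P (λ s′ → sumZ Q (λ t′ → sumZ Z (λ ζ → c s′ t′ * 𝟙 (f ζ s′ t′ ≤? r))))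
        ≡⟨ trans (sumZ-cong P (λ _ → sumZ-swap _ Q Z)) (sumZ-swap _ P Z) ⟩
      sumZ Z (λ ζ → sumZ P (λ s′ → sumZ Q (λ t′ → c s′ t′ * 𝟙 (f ζ s′ t′ ≤? r))))
        ≡⟨ sumZ-cong Z (λ ζ∈ → maxIs-sum ζ∈ sr) ⟩
      sumZ Z (λ ζ → 𝟙 (maxIs? p q r s t ζ))
        ≡⟨ count-sumZ (maxIs? p q r s t) Z ⟨
      + coeff p q s t r ∎
      where
      open ≡-Reasoning
      T = trees (p + q)
      P = trees p
      Q = trees q
      Z = Sh p q
      c : BT → BT → ℤ
      c s′ t′ = M s s′ * M t t′
      move : ∀ a b c → a * (b * c) ≡ b * (a * c)
      move = solve-∀

    -- The theorem compares coefficients at every tree `u`, and this settles the trees outside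
    -- degree `p + q`.
    prod-homogeneous : ∀ {X Y u} → size u ≢ p + q → prod p q X Y u ≡ 0ℤ
    prod-homogeneous {X} {Y} {u} ne = sumZ-0 (trees p) λ {s′} s′∈ → sumZ-0 (trees q) λ {t′} t′∈ →
      trans (cong (X s′ * Y t′ *_) (trans (count-sumZ _ (Sh p q)) (sumZ-0 (Sh p q) (λ {ζ} ζ∈ →
        𝟙-no (f ζ s′ t′ ≟BT u) (λ eq → ne (trans (cong size (sym eq)) (Shuffle.f-size {p} {q} ζ∈ (∈-trees⁻ s′∈) (∈-trees⁻ t′∈))))))))
        (ℤ.*-zeroʳ (X s′ * Y t′))

-- The coefficients of the product on the monomial basis are expressed through its expansion,
-- compared at every `F` basis element. By `downSum-combination` the expansion determines them.
theorem4p2 : (_≤?_ : Decidable _≤T_) (p q : ℕ) → 1 ≤ p → 1 ≤ q →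
    (s t : BT) → size s ≡ p → size t ≡ q →
    let open WithDec _≤?_ in
    (u : BT) →
    prod p q (M s) (M t) u ≡ sumZ (trees (p + q)) (λ r → + coeff p q s t r * M r u)
theorem4p2 _≤?_ p q _ _ s t ss st≡ u with size u ≟ p + q
... | yes su = downSum-injective
        (λ sr → trans (downSum-prod sr) (sym (downSum-combination (λ r → + coeff p q s t r) sr))) su
  where
  open WithDec _≤?_
  open Möbius _≤?_
  open Product ss st≡
-- The order relates only trees of equal size, so `M r u` is zero for every `r` of size `p + q`.
... | no ne = trans (prod-homogeneous {M s} {M t} ne) (sym (sumZ-0 (trees (p + q)) λ {r} r∈ →
        trans (cong (+ coeff p q s t r *_) (M-≰ (λ r≤u → ne (trans (sym (≤T-size r≤u)) (∈-trees⁻ r∈)))))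
              (ℤ.*-zeroʳ (+ coeff p q s t r))))
  where
  open WithDec _≤?_
  open Möbius _≤?_
  open Product ss st≡
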